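{- Let $q=3^d$ with $d\geq 1$ and let $E\colon y^2=x^3+a_4x+a_6$ be a supersingular elliptic curve over $\mathbb{F}_q$ (so $a_4\ne 0$). Suppose $d$ is odd. If $-a_4=v^4$ for some $v\in\mathbb{F}_q^\times$, then \[\#E(\mathbb{F}_q)=\begin{cases} q+1 & \text{if } \operatorname{Tr}(a_6v^{ -6})=0,\\ q+1+\sqrt{3q} & \text{if } \operatorname{Tr}(a_6v^{ -6})=1 \text{ and } d\equiv1\pmod 4,\\ q+1-\sqrt{3q} & \text{if } \operatorname{Tr}(a_6v^{ -6})=1 \text{ and } d\equiv3\pmod 4,\\ q+1-\sqrt{3q} & \text{if } \operatorname{Tr}(a_6v^{ -6})=-1 \text{ and } d\equiv1\pmod 4,\\ q+1+\sqrt{3q} & \text{if } \operatorname{Tr}(a_6v^{ -6})=-1 \text{ and } d\equiv3\pmod 4. \end{cases}\] Otherwise (if $-a_4$ is not a fourth power in $\mathbb{F}_q^\times$), $\#E(\mathbb{F}_q)=q+1$. Suppose $d$ is even. If $-a_4=\gamma^2$ for some $\gamma\in\mathbb{F}_q^\times$ and $\gamma$ is a square in $\mathbb{F}_q^\times$, then \[\#E(\mathbb{F}_q)=\begin{cases} q+1-2\sqrt q & \text{if } \operatorname{Tr}(a_6\gamma^{ -3})=0 \text{ and } d\equiv0\pmod4,\\ q+1+2\sqrt q & \text{if } \operatorname{Tr}(a_6\gamma^{ -3})=0 \text{ and } d\equiv2\pmod4,\\ q+1+\sqrt q & \text{if } \operatorname{Tr}(a_6\gamma^{ -3})\neq0 \text{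 and } d\equiv0\pmod4,\\ q+1-\sqrt q & \text{if } \operatorname{Tr}(a_6\gamma^{ -3})\neq0 \text{ and } d\equiv2\pmod4. \end{cases}\] If $-a_4=\gamma^2$ for some $\gamma\in\mathbb{F}_q^\times$ and $\gamma$ is not a square in $\mathbb{F}_q^\times$, then \[\#E(\mathbb{F}_q)=\begin{cases} q+1+2\sqrt q & \text{if } \operatorname{Tr}(a_6\gamma^{ -3})=0 \text{ and } d\equiv0\pmod4,\\ q+1-2\sqrt q & \text{if } \operatorname{Tr}(a_6\gamma^{ -3})=0 \text{ and } d\equiv2\pmod4,\\ q+1-\sqrt q & \text{if } \operatorname{Tr}(a_6\gamma^{ -3})\neq0 \text{ and } d\equiv0\pmod4,\\ q+1+\sqrt q & \text{if } \operatorname{Tr}(a_6\gamma^{ -3})\neq0 \text{ and } d\equiv2\pmod4. \end{cases}\] Finally, if $-a_4$ is not a square in $\mathbb{F}_q^\times$, then $\#E(\mathbb{F}_q)=q+1$.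
   Context: $\operatorname{Tr}$ denotes the trace map $\mathbb{F}_q\to\mathbb{F}_3$, with $\mathbb{F}_3=\{0,1,-1\}$. $\#E(\mathbb{F}_q)$ counts all $\mathbb{F}_q$-rational points, including the point at infinity. -}

module Defs where

open import Algebra.Apartness.Bundles using (HeytingField; HeytingCommutativeRing)
open import Algebra.Bundles using (CommutativeRing; Semiring)
import Algebra.Definitions.RawSemiring as RawSemiringDefs
open import Algebra.Morphism.Structures using (module RingMorphisms)
open import Data.Fin.Base using (Fin; toℕ)
import Data.Fin.Properties as Fin
open import Data.List.Base using (List; allFin; cartesianProduct; filter; length; map)
open import Data.Nat.Base as ℕ using (ℕ; zero; suc)
open import Data.Product.Base using (_×_; _,_; ∃-syntax; proj₁)
open import Function.Bundles using (Inverse)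
import Function.Properties.Inverse as InverseProperties
open import Level using (Level; _⊔_) renaming (suc to lsuc)
open import Relation.Binary.Definitions using (Decidable)
open import Relation.Binary.PropositionalEquality as ≡ using (_≡_)
open import Relation.Nullary.Decidable using (via-injection)

private
  variable
    c ℓ₁ ℓ₂ : Level

-- Fields are the library's Heyting fields. In a finite field equality is
-- decidable and x # y is equivalent to ¬ (x ≈ y), so x # 0# says x ≠ 0.
module Field (F : HeytingField c ℓ₁ ℓ₂) where

  open HeytingField F public

  commutativeRing : CommutativeRing c ℓ₁
  commutativeRing = HeytingCommutativeRing.commutativeRing heytingCommutativeRing

  open CommutativeRing commutativeRing public using (rawRing)
  open RawSemiringDefs (Semiring.rawSemiring (CommutativeRing.semiring commutativeRing)) public
    using (_^_; sum) renaming (_×_ to _•_)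

  -- #⇒invertible inverts x - 0#, which equals x.
  inv : ∀ {x} → x # 0# → Carrier
  inv x#0 = proj₁ (#⇒invertible x#0)

  IsNonzeroSquare : Carrier → Set (c ⊔ ℓ₁ ⊔ ℓ₂)
  IsNonzeroSquare x = ∃[ w ] w # 0# × x ≈ w ^ 2

  IsNonzeroFourthPower : Carrier → Set (c ⊔ ℓ₁ ⊔ ℓ₂)
  IsNonzeroFourthPower x = ∃[ w ] w # 0# × x ≈ w ^ 4

  -- Trace from the field with 3 ^ d elements to its prime field {0, 1, -1}, as
  -- the sum of the conjugates x ^ (3 ^ i), i < d. Its values are regarded as
  -- elements of the big field.
  Tr : ℕ → Carrier → Carrier
  Tr d x = sum {d} (λ i → x ^ (3 ℕ.^ toℕ i))

HasOrder : HeytingField c ℓ₁ ℓ₂ → ℕ → Set (c ⊔ ℓ₁)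
HasOrder F q = Inverse (≡.setoid (Fin q)) (HeytingField.setoid F)

-- The curve y² = x³ + a₄ x + a₆.
record ShortWeierstrass (F : HeytingField c ℓ₁ ℓ₂) : Set c where
  constructor shortWeierstrass
  open HeytingField F
  field
    a₄ a₆ : Carrier

module Curve (F : HeytingField c ℓ₁ ℓ₂) (E : ShortWeierstrass F) where

  open Field F
  open ShortWeierstrass E

  OnCurve : Carrier → Carrier → Set ℓ₁
  OnCurve x y = y ^ 2 ≈ x ^ 3 + a₄ * x + a₆

  discriminant : Carrier
  discriminant = - (16 • (4 • a₄ ^ 3 + 27 • a₆ ^ 2))

  IsElliptic : Set ℓ₂
  IsElliptic = discriminant # 0#

  data Point : Set (c ⊔ ℓ₁) where
    ∞      : Point
    affine : ∀ x y → OnCurve x y → Point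

  data _≈ₚ_ : Point → Point → Set (c ⊔ ℓ₁) where
    ∞≈∞     : ∞ ≈ₚ ∞
    affine≈ : ∀ {x y p x′ y′ p′} → x ≈ x′ → y ≈ y′ →
              affine x y p ≈ₚ affine x′ y′ p′

  -- The chord-and-tangent group law, given as the graph P ⊕ Q ≗ R of addition
  -- because equality over a general field need not be decidable; m is the slope
  -- of the line through P and Q.
  data _⊕_≗_ : Point → Point → Point → Set (c ⊔ ℓ₁ ⊔ ℓ₂) where
    identityˡ : ∀ {Q R} → Q ≈ₚ R → ∞ ⊕ Q ≗ R
    identityʳ : ∀ {P R} → P ≈ₚ R → P ⊕ ∞ ≗ R
    inverse   : ∀ {x₁ y₁ p₁ x₂ y₂ p₂} →
                x₁ ≈ x₂ → y₁ ≈ - y₂ →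
                affine x₁ y₁ p₁ ⊕ affine x₂ y₂ p₂ ≗ ∞
    chord     : ∀ {x₁ y₁ p₁ x₂ y₂ p₂ x₃ y₃ p₃} m →
                x₁ # x₂ →
                m * (x₂ - x₁) ≈ y₂ - y₁ →
                x₃ ≈ m ^ 2 - x₁ - x₂ → y₃ ≈ m * (x₁ - x₃) - y₁ →
                affine x₁ y₁ p₁ ⊕ affine x₂ y₂ p₂ ≗ affine x₃ y₃ p₃
    tangent   : ∀ {x₁ y₁ p₁ x₂ y₂ p₂ x₃ y₃ p₃} m →
                x₁ ≈ x₂ → y₁ ≈ y₂ → 2 • y₁ # 0# →
                m * (2 • y₁) ≈ 3 • x₁ ^ 2 + a₄ →
                x₃ ≈ m ^ 2 - x₁ - x₂ → y₃ ≈ m * (x₁ - x₃) - y₁ →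
                affine x₁ y₁ p₁ ⊕ affine x₂ y₂ p₂ ≗ affine x₃ y₃ p₃

  -- n · P ≗ Q : the n-fold sum of P with itself is Q.
  data _·_≗_ : ℕ → Point → Point → Set (c ⊔ ℓ₁ ⊔ ℓ₂) where
    zero· : ∀ {P} → 0 · P ≗ ∞
    suc·  : ∀ {n P Q R} → n · P ≗ Q → Q ⊕ P ≗ R → suc n · P ≗ R

  module Rational {q : ℕ} (F-order : HasOrder F q) where

    _≟_ : Decidable _≈_
    _≟_ = via-injection (InverseProperties.Inverse⇒Injection (InverseProperties.sym F-order)) Fin._≟_

    elements : List Carrier
    elements = map (Inverse.to F-order) (allFin q)

    affinePoints : List (Carrier × Carrier)
    affinePoints =
      filter (λ (x , y) → (y ^ 2) ≟ (x ^ 3 + a₄ * x + a₆))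
             (cartesianProduct elements elements)

    -- The extra point is the point at infinity.
    #E : ℕ
    #E = suc (length affinePoints)

baseChange : (F K : HeytingField c ℓ₁ ℓ₂) →
             (HeytingField.Carrier F → HeytingField.Carrier K) →
             ShortWeierstrass F → ShortWeierstrass K
baseChange F K σ E = shortWeierstrass (σ a₄) (σ a₆)
  where open ShortWeierstrass E

-- For F of characteristic p: E has no nontrivial p-torsion over any extension
-- field K of F. This is the usual definition E[p] = O over an algebraic closure,
-- since the coordinates of p-torsion points are algebraic over F.
IsSupersingular : ∀ {c ℓ₁ ℓ₂} → ℕ → (F : HeytingField c ℓ₁ ℓ₂) →
                  ShortWeierstrass F → Set (lsuc (c ⊔ ℓ₁ ⊔ ℓ₂))
IsSupersingular {c} {ℓ₁} {ℓ₂} p F E =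
  ∀ (K : HeytingField c ℓ₁ ℓ₂)
    (σ : HeytingField.Carrier F → HeytingField.Carrier K) →
    RingMorphisms.IsRingHomomorphism (Field.rawRing F) (Field.rawRing K) σ →
    let open Curve K (baseChange F K σ E) in
    ∀ P → p · P ≗ ∞ → P ≡ ∞

{-# OPTIONS --safe #-}
module Submission where

-- If -a₄ = γ², replacing x by γ x turns the equation of the curve into x³ - x = δ³ y² - δ³ a₆ with δ = γ⁻¹. By
-- additive Hilbert 90 the number of affine points is therefore 3 times the number of y with Tr (δ³ y²) = Tr (δ³ a₆).
-- Replacing δ³ by a square factor changes nothing, and a nonsquare factor reflects the counts in their mean q / 3, so
-- everything reduces to the numbers N₀, N₁, N₂ of y with Tr (y²) = 0, 1, -1.
--
-- Factoring x² - y² gives N₀² + N₁² + N₂² = q + (q - 1) q / 3. Together with N₀ + N₁ + N₂ = q, and with N₁ = N₂ or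
-- N₁ + N₂ = 2 q / 3 according to whether -1 is a square, this expresses the Nⱼ by a square root s of a power of 3;
-- that the exponent is even ties the two cases to the parity of d.
--
-- The sign of s comes from a parity argument. The polynomial X + X³ + ... + X^(q/3) + 1 is the product of the X - r
-- over the r of trace -1, so the elements of trace 1 have product 1. Hence an even number of them are nonsquares,
-- which determines N₁ modulo 4 and gives s ≡ s² (mod 4), that is s = (-3)ʲ.
-- If -a₄ is not a square, x³ + a₄ x is a bijection and there are q affine points.

import Algebra.Apartness.Properties.HeytingCommutativeRing as HeytingProperties
import Algebra.Definitions.RawSemiring as RawSemiringDefs
import Algebra.Morphism.RingMonomorphism as RingMonomorphism
import Algebra.Properties.AbelianGroup as AbelianGroupProperties
import Algebra.Properties.CommutativeMonoid.Sum as CommutativeMonoidSum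
import Algebra.Properties.Group as GroupProperties
import Algebra.Properties.Monoid.Mult as MonoidMult
import Algebra.Properties.Monoid.Sum as MonoidSum
import Algebra.Properties.Ring as RingProperties
import Algebra.Properties.Semiring.Exp as Exp
import Algebra.Properties.Semiring.Mult as Mult
import Algebra.Properties.Semiring.Sum as SemiringSum
import Algebra.Solver.Ring as RingSolver
import Data.Integer as ℤ
import Data.Integer.Properties as ℤ
import Data.List.Relation.Unary.All.Properties as All
import Data.List.Relation.Unary.Unique.Propositional.Properties as Unique
import Data.Nat.ListAction as ListAction
import Data.Nat.Properties as ℕ
import Data.Nat.Tactic.RingSolver as ℕ-Solver
import Relation.Binary.Reasoning.Setoid as SetoidReasoning
open import Algebra.Apartness.Bundles using (HeytingField)
open import Algebra.Bundles using (CommutativeMonoid; CommutativeRing; RawRing; Semiring)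
open import Algebra.Morphism.Structures using (IsRingMonomorphism)
open import Algebra.Solver.Ring.AlmostCommutativeRing using (AlmostCommutativeRing; fromCommutativeRing; _-Raw-AlmostCommutative⟶_)
open import Algebra.Structures using (IsCommutativeRing)
open import Data.Bool.Base using (if_then_else_; true; false)
open import Data.Fin.Base using (Fin; zero; suc; toℕ)
open import Data.Fin.Permutation using (permutation)
open import Data.Fin.Properties using (_≟_; any?)
open import Data.Integer.Divisibility.Signed using (∣ᵤ⇒∣; divides)
open import Data.Integer.Tactic.RingSolver using (solve-∀)
open import Data.List.Base as List using (List; []; _∷_; _++_; allFin; cartesianProduct; filter; foldr; length; tabulate)
open import Data.List.Properties using (filter-++; length-++; map-tabulate; map-∘)
open import Data.List.Relation.Unary.All as All using (All; []; _∷_)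
open import Data.List.Relation.Unary.AllPairs using ([]; _∷_)
open import Data.List.Relation.Unary.Unique.Propositional using (Unique)
open import Data.Maybe.Base using (Maybe; just; nothing)
open import Data.Nat as ℕ using (ℕ; zero; suc; _≤_; z≤n; s≤s; _≤′_; ≤′-refl; ≤′-step)
open import Data.Nat.Divisibility as ℕ using (_∣_; m∣m*n)
open import Data.Nat.DivMod using (_%_; [m+kn]%n≡m%n)
open import Data.Nat.Primality using (Prime; prime?; euclidsLemma)
open import Data.Product using (_×_; _,_; ∃-syntax; proj₁; proj₂)
open import Data.Sum using (_⊎_; inj₁; inj₂; [_,_]′)
open import Function.Base using (_∘_; id)
open import Function.Bundles using (Inverse)
open import Function.Definitions using (Injective)
open import Level using (Level; 0ℓ)
open import Relation.Binary.PropositionalEquality as ≡ using (_≡_; _≢_; cong; cong₂; subst; module ≡-Reasoning)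
open import Relation.Nullary using (¬_; Dec; yes; no; does; contradiction; ¬?)
open import Relation.Nullary.Decidable using (toWitness)
open import Relation.Unary using (Pred; Decidable)
open import Defs

-- The integer s is the quadratic Gauss sum in disguise: for ω a primitive cube root of unity, N₀ +
-- N₁ ω + N₂ ω² is s (ω - ω²) if -1 is not a square and -s if it is. Its absolute value is easy; its
-- sign is the obstacle. Working with counts in place of characters keeps everything in ℕ and ℤ, and
-- a congruence takes the place of the usual lifting of Gauss sums from the prime field: s is odd,
-- so s² ≡ 1 and hence s ≡ 1 (mod 4), and since -3 ≡ 1 (mod 4) the square root of 3²ʲ with this
-- property is (-3)ʲ.
--
-- Exact counts come without homomorphism theorems. Each fibre of a map is bounded from above,
-- mostly by the degree of a polynomial; the bounds add up to a total that is already known, so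
-- every bound is attained. This one principle yields the fibres of the trace, additive Hilbert 90
-- and the balance between squares and nonsquares.

-- Finite sums, indicators and fibre counts.

module FiniteSums where

  open ≡ using (refl; sym; trans)

  private
    variable
      a p p′ : Level
      n : ℕ

  open SemiringSum ℕ.+-*-semiring public using ()
    renaming (sum to ∑; ∑-comm to ∑-swap; ∑-distrib-+ to ∑-+; *-distribʳ-sum to ∑-*ʳ; *-distribˡ-sum to ∑-*ˡ;
              sum-cong-≗ to ∑-cong)

  ⟦_⟧ : {P : Set p} → Dec P → ℕ
  ⟦ P? ⟧ = if does P? then 1 else 0

  ⟦⟧-yes : {P : Set p} (P? : Dec P) → P → ⟦ P? ⟧ ≡ 1
  ⟦⟧-yes (yes _) _ = refl
  ⟦⟧-yes (no ¬p) p = contradiction p ¬p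

  ⟦⟧-no : {P : Set p} (P? : Dec P) → ¬ P → ⟦ P? ⟧ ≡ 0
  ⟦⟧-no (yes p) ¬p = contradiction p ¬p
  ⟦⟧-no (no _)  _  = refl

  ⟦⟧-cong : {P : Set p} {Q : Set p′} (P? : Dec P) (Q? : Dec Q) → (P → Q) → (Q → P) → ⟦ P? ⟧ ≡ ⟦ Q? ⟧
  ⟦⟧-cong (yes p) Q? f g = sym (⟦⟧-yes Q? (f p))
  ⟦⟧-cong (no ¬p) Q? f g = sym (⟦⟧-no Q? (¬p ∘ g))

  ∑-const : ∀ n c → ∑ {n} (λ _ → c) ≡ n ℕ.* c
  ∑-const zero    c = refl
  ∑-const (suc n) c = cong (c ℕ.+_) (∑-const n c)

  ∑-mono : (f g : Fin n → ℕ) → (∀ i → f i ≤ g i) → ∑ f ≤ ∑ g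
  ∑-mono {zero}  f g f≤g = z≤n
  ∑-mono {suc n} f g f≤g = ℕ.+-mono-≤ (f≤g zero) (∑-mono (f ∘ suc) (g ∘ suc) (f≤g ∘ suc))

  -- Slack in one term could not be made up by the others. This turns upper bounds on fibres into
  -- exact counts once the totals are known to agree.
  ∑-squeeze : (f g : Fin n → ℕ) → (∀ i → f i ≤ g i) → ∑ g ≤ ∑ f → ∀ i → f i ≡ g i
  ∑-squeeze {suc n} f g f≤g ∑g≤∑f = go
    where
    tail≤ : ∑ (f ∘ suc) ≤ ∑ (g ∘ suc)
    tail≤ = ∑-mono (f ∘ suc) (g ∘ suc) (f≤g ∘ suc)

    head≡ : f zero ≡ g zero
    head≡ = ℕ.≤-antisym (f≤g zero)
      (ℕ.+-cancelʳ-≤ (∑ (g ∘ suc)) _ _ (ℕ.≤-trans ∑g≤∑f (ℕ.+-monoʳ-≤ (f zero) tail≤)))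

    go : ∀ i → f i ≡ g i
    go zero    = head≡
    go (suc i) = ∑-squeeze (f ∘ suc) (g ∘ suc) (f≤g ∘ suc)
      (ℕ.+-cancelˡ-≤ (g zero) _ _ (subst (λ h → ∑ g ≤ h ℕ.+ ∑ (f ∘ suc)) head≡ ∑g≤∑f)) i

  ∑-δ : (a : Fin n) (g : Fin n → ℕ) → ∑ (λ z → ⟦ a ≟ z ⟧ ℕ.* g z) ≡ g a
  ∑-δ {suc n} zero g = begin
    1 ℕ.* g zero ℕ.+ ∑ {n} (λ _ → 0) ≡⟨ cong₂ ℕ._+_ (ℕ.*-identityˡ (g zero)) (trans (∑-const n 0) (ℕ.*-zeroʳ n)) ⟩
    g zero ℕ.+ 0                     ≡⟨ ℕ.+-identityʳ _ ⟩
    g zero                           ∎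
    where open ≡-Reasoning
  ∑-δ (suc a) g = ∑-δ a (g ∘ suc)

  ∑-⟦≟⟧ : (a : Fin n) → ∑ (λ z → ⟦ a ≟ z ⟧) ≡ 1
  ∑-⟦≟⟧ a = trans (∑-cong (λ z → sym (ℕ.*-identityʳ ⟦ a ≟ z ⟧))) (∑-δ a (λ _ → 1))

  module _ {k : ℕ} where

    fibre : (Fin n → Fin k) → Fin k → ℕ
    fibre f z = ∑ (λ x → ⟦ f x ≟ z ⟧)

    -- Inserting `∑-δ` and exchanging the sums groups the terms by the value of `f`.
    ∑-∘ : (f : Fin n → Fin k) (g : Fin k → ℕ) → ∑ (g ∘ f) ≡ ∑ (λ z → fibre f z ℕ.* g z)
    ∑-∘ f g = begin
      ∑ (λ x → g (f x))                          ≡⟨ ∑-cong (λ x → ∑-δ (f x) g) ⟨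
      ∑ (λ x → ∑ (λ z → ⟦ f x ≟ z ⟧ ℕ.* g z))    ≡⟨ ∑-swap (λ x z → ⟦ f x ≟ z ⟧ ℕ.* g z) ⟩
      ∑ (λ z → ∑ (λ x → ⟦ f x ≟ z ⟧ ℕ.* g z))    ≡⟨ ∑-cong (λ z → ∑-*ʳ (g z) (λ x → ⟦ f x ≟ z ⟧)) ⟨
      ∑ (λ z → fibre f z ℕ.* g z)                ∎
      where open ≡-Reasoning

    ∑-fibre : (f : Fin n → Fin k) → ∑ (fibre f) ≡ n
    ∑-fibre {n} f = begin
      ∑ (fibre f)                   ≡⟨ ∑-cong (λ z → ℕ.*-identityʳ (fibre f z)) ⟨
      ∑ (λ z → fibre f z ℕ.* 1)     ≡⟨ ∑-∘ f (λ _ → 1) ⟨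
      ∑ {n} (λ _ → 1)               ≡⟨ ∑-const n 1 ⟩
      n ℕ.* 1                       ≡⟨ ℕ.*-identityʳ n ⟩
      n                             ∎
      where open ≡-Reasoning

    fibre-injective : (f : Fin n → Fin k) → Injective _≡_ _≡_ f → ∀ z → fibre f z ≤ 1
    fibre-injective {n} f f-inj z with any? (λ x → f x ≟ z)
    ... | yes (x , refl) = ℕ.≤-reflexive (trans
      (∑-cong (λ y → ⟦⟧-cong (f y ≟ f x) (x ≟ y) (sym ∘ f-inj) (λ { refl → refl }))) (∑-⟦≟⟧ x))
    ... | no ∄x = ℕ.≤-trans (ℕ.≤-reflexive (trans
      (∑-cong (λ y → ⟦⟧-no (f y ≟ z) (λ fy≡z → ∄x (y , fy≡z)))) (trans (∑-const n 0) (ℕ.*-zeroʳ n)))) z≤n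

  -- An injective self-map has all fibres of size 1, because the fibre sizes add up to n.
  ∑-injective : (f : Fin n → Fin n) → Injective _≡_ _≡_ f → (g : Fin n → ℕ) → ∑ (g ∘ f) ≡ ∑ g
  ∑-injective {n} f f-inj g = begin
    ∑ (g ∘ f)                      ≡⟨ ∑-∘ f g ⟩
    ∑ (λ z → fibre f z ℕ.* g z)    ≡⟨ ∑-cong (λ z → cong (ℕ._* g z) (fibre≡1 z)) ⟩
    ∑ (λ z → 1 ℕ.* g z)            ≡⟨ ∑-cong (λ z → ℕ.*-identityˡ (g z)) ⟩
    ∑ g                            ∎
    where
    open ≡-Reasoning
    fibre≡1 : ∀ z → fibre f z ≡ 1
    fibre≡1 = ∑-squeeze (fibre f) (λ _ → 1) (fibre-injective f f-inj)
      (ℕ.≤-reflexive (trans (trans (∑-const n 1) (ℕ.*-identityʳ n)) (sym (∑-fibre f))))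

  module _ {A : Set a} {P : Pred A p} (P? : Decidable P) where

    length-filter-tabulate : (f : Fin n → A) → length (filter P? (tabulate f)) ≡ ∑ (λ i → ⟦ P? (f i) ⟧)
    length-filter-tabulate {zero}  f = refl
    length-filter-tabulate {suc n} f with does (P? (f zero))
    ... | true  = cong suc (length-filter-tabulate (f ∘ suc))
    ... | false = length-filter-tabulate (f ∘ suc)

  length-filter-cartesianProduct : ∀ {A : Set a} {P : Pred (A × A) p} (P? : Decidable P) {k} (f : Fin k → A) (g : Fin n → A) →
    length (filter P? (cartesianProduct (tabulate f) (tabulate g))) ≡ ∑ (λ i → ∑ (λ j → ⟦ P? (f i , g j) ⟧))
  length-filter-cartesianProduct P? {zero}  f g = refl
  length-filter-cartesianProduct P? {suc k} f g = begin
    length (filter P? (row ++ rest))                      ≡⟨ cong length (filter-++ P? row rest) ⟩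
    length (filter P? row ++ filter P? rest)              ≡⟨ length-++ (filter P? row) ⟩
    length (filter P? row) ℕ.+ length (filter P? rest)    ≡⟨ cong₂ ℕ._+_ (cong (length ∘ filter P?) (map-tabulate g (f zero ,_))) refl ⟩
    length (filter P? (tabulate (λ j → f zero , g j))) ℕ.+ length (filter P? rest)
      ≡⟨ cong₂ ℕ._+_ (length-filter-tabulate P? (λ j → f zero , g j)) (length-filter-cartesianProduct P? (f ∘ suc) g) ⟩
    ∑ (λ i → ∑ (λ j → ⟦ P? (f i , g j) ⟧))                ∎
    where
    open ≡-Reasoning
    row  = List.map (f zero ,_) (tabulate g)
    rest = cartesianProduct (tabulate (f ∘ suc)) (tabulate g)

  -- Links lists of roots, along which polynomials are factored, with the indicator sums used for
  -- counting.
  sum-map-filter-tabulate : ∀ {a p} {A : Set a} {P : Pred A p} (P? : Decidable P) (h : A → ℕ) {n} (f : Fin n → A) →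
    ListAction.sum (List.map h (filter P? (tabulate f))) ≡ ∑ (λ i → ⟦ P? (f i) ⟧ ℕ.* h (f i))
  sum-map-filter-tabulate P? h {zero}  f = refl
  sum-map-filter-tabulate P? h {suc n} f with P? (f zero)
  ... | yes _ = cong₂ ℕ._+_ (sym (ℕ.*-identityˡ _)) (sum-map-filter-tabulate P? h (f ∘ suc))
  ... | no  _ = sum-map-filter-tabulate P? h (f ∘ suc)

open FiniteSums

-- Working on Fin n makes equality propositional and decidable; a field F in the setoid sense is moved here along HasOrder.
record FiniteField (n : ℕ) : Set where
  infix  8 -_
  infixl 7 _*_
  infixl 6 _+_
  field
    _+_ _*_           : Fin n → Fin n → Fin n
    -_                : Fin n → Fin n
    0# 1#             : Fin n
    isCommutativeRing : IsCommutativeRing _≡_ _+_ _*_ -_ 0# 1#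
    0≢1               : 0# ≢ 1#
    inverse           : ∀ x → x ≢ 0# → ∃[ y ] y * x ≡ 1#

  commutativeRing : CommutativeRing 0ℓ 0ℓ
  commutativeRing = record { isCommutativeRing = isCommutativeRing }

  open CommutativeRing commutativeRing public
    using (_-_; +-comm; +-assoc; +-identityˡ; +-identityʳ; -‿inverseˡ; -‿inverseʳ; *-comm; *-assoc;
           *-identityˡ; *-identityʳ; zeroˡ; zeroʳ; semiring; +-group; +-commutativeMonoid; *-commutativeMonoid)
  open RawSemiringDefs (Semiring.rawSemiring semiring) public using (_^_)
    renaming (_×_ to _•_)

module _ {c ℓ} (M : CommutativeMonoid c ℓ) where

  open CommutativeMonoid M renaming (refl to ≈-refl; trans to ≈-trans)
  open CommutativeMonoidSum M using (sum; sum-replicate-zero)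

  -- Stated for any commutative monoid because `fermat` applies it to multiplication, where `sum` is
  -- a product and `ε` is 1.
  sum-single : ∀ {n} (a : Fin n) x → sum (λ z → if does (a ≟ z) then x else ε) ≈ x
  sum-single {suc n} zero x = ≈-trans (∙-congˡ (sum-replicate-zero n)) (identityʳ x)
  sum-single (suc a) x = ≈-trans (identityˡ _) (sum-single a x)

-- General facts on finite fields: cancellation, Fermat, characteristic.

module FiniteFieldProperties {n : ℕ} (K : FiniteField n) where

  open FiniteField K
  open GroupProperties +-group using (identityʳ-unique)
  open ≡ using (refl; sym; trans)

  private
    open module Σ = CommutativeMonoidSum +-commutativeMonoid
      using (sum)
    open module Π = CommutativeMonoidSum *-commutativeMonoid
      using () renaming (sum to product)

  *-cancelˡ-≢0 : ∀ {x y z} → x ≢ 0# → x * y ≡ x * z → y ≡ z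
  *-cancelˡ-≢0 {x} {y} {z} x≢0 xy≡xz with x⁻¹ , x⁻¹x≡1 ← inverse x x≢0 = begin
    y              ≡⟨ *-identityˡ y ⟨
    1# * y         ≡⟨ cong (_* y) x⁻¹x≡1 ⟨
    x⁻¹ * x * y    ≡⟨ *-assoc x⁻¹ x y ⟩
    x⁻¹ * (x * y)  ≡⟨ cong (x⁻¹ *_) xy≡xz ⟩
    x⁻¹ * (x * z)  ≡⟨ *-assoc x⁻¹ x z ⟨
    x⁻¹ * x * z    ≡⟨ cong (_* z) x⁻¹x≡1 ⟩
    1# * z         ≡⟨ *-identityˡ z ⟩
    z              ∎
    where open ≡-Reasoning

  *≡0⇒≡0 : ∀ {x y} → x * y ≡ 0# → x ≡ 0# ⊎ y ≡ 0#
  *≡0⇒≡0 {x} {y} xy≡0 with x ≟ 0#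
  ... | yes x≡0 = inj₁ x≡0
  ... | no  x≢0 = inj₂ (*-cancelˡ-≢0 x≢0 (trans xy≡0 (sym (zeroʳ x))))

  *-≢0 : ∀ {x y} → x ≢ 0# → y ≢ 0# → x * y ≢ 0#
  *-≢0 x≢0 y≢0 xy≡0 with *≡0⇒≡0 xy≡0
  ... | inj₁ x≡0 = x≢0 x≡0
  ... | inj₂ y≡0 = y≢0 y≡0

  ^≡0⇒≡0 : ∀ {x} k → x ^ k ≡ 0# → x ≡ 0#
  ^≡0⇒≡0 zero    1≡0 = contradiction (sym 1≡0) 0≢1
  ^≡0⇒≡0 (suc k) xᵏ⁺¹≡0 with *≡0⇒≡0 xᵏ⁺¹≡0
  ... | inj₁ x≡0  = x≡0
  ... | inj₂ xᵏ≡0 = ^≡0⇒≡0 k xᵏ≡0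

  -- Translating by 1 permutes the field, hence preserves the sum of all elements.
  cardinality•1≡0 : n • 1# ≡ 0#
  cardinality•1≡0 = identityʳ-unique (sum id) (n • 1#) (begin
    sum id + n • 1#                       ≡⟨ cong (sum id +_) (Σ.sum-replicate n) ⟨
    sum id + sum {n} (λ _ → 1#)           ≡⟨ Σ.∑-distrib-+ id (λ _ → 1#) ⟨
    sum (_+ 1#)                           ≡⟨ Σ.sum-permute id shift ⟨
    sum id                                ∎)
    where
    open ≡-Reasoning
    shift = permutation (_+ 1#) (_+ - 1#)
      (λ x → trans (+-assoc x (- 1#) 1#) (trans (cong (x +_) (-‿inverseˡ 1#)) (+-identityʳ x)))
      (λ x → trans (+-assoc x 1# (- 1#)) (trans (cong (x +_) (-‿inverseʳ 1#)) (+-identityʳ x)))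

  product-≢0 : ∀ {k} (f : Fin k → Fin n) → (∀ i → f i ≢ 0#) → product f ≢ 0#
  product-≢0 {zero}  f f≢0 = 0≢1 ∘ sym
  product-≢0 {suc k} f f≢0 = *-≢0 (f≢0 zero) (product-≢0 (f ∘ suc) (f≢0 ∘ suc))

  -- Multiplication by x permutes the nonzero elements; `unit` replaces 0 by 1 in their product.
  fermat : ∀ x → x ≢ 0# → x ^ n ≡ x
  fermat x x≢0 with x⁻¹ , x⁻¹x≡1 ← inverse x x≢0 = begin
    x ^ n                                 ≡⟨ Π.sum-replicate n ⟨
    product {n} (λ _ → x)                 ≡⟨ Π.sum-cong-≗ split ⟨
    product (λ z → off0 z * at0 z)       ≡⟨ Π.∑-distrib-+ off0 at0 ⟩
    product off0 * product at0           ≡⟨ cong₂ _*_ product-off0 (sum-single *-commutativeMonoid 0# x) ⟩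
    1# * x                                ≡⟨ *-identityˡ x ⟩
    x                                     ∎
    where
    open ≡-Reasoning
    unit off0 at0 : Fin n → Fin n
    unit  z = if does (0# ≟ z) then 1# else z
    off0 z = if does (0# ≟ z) then 1# else x
    at0   z = if does (0# ≟ z) then x else 1#

    split : ∀ z → off0 z * at0 z ≡ x
    split z with does (0# ≟ z)
    ... | true  = *-identityˡ x
    ... | false = *-identityʳ x

    unit-≢0 : ∀ z → unit z ≢ 0#
    unit-≢0 z with 0# ≟ z
    ... | yes _   = 0≢1 ∘ sym
    ... | no  0≢z = 0≢z ∘ sym

    unit-* : ∀ z → unit (x * z) ≡ unit z * off0 z
    unit-* z with 0# ≟ z | 0# ≟ x * z
    ... | yes _    | yes _   = sym (*-identityˡ 1#)
    ... | yes refl | no 0≢x0 = contradiction (sym (zeroʳ x)) 0≢x0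
    ... | no 0≢z   | yes 0≡xz = contradiction (sym 0≡xz) (*-≢0 x≢0 (0≢z ∘ sym))
    ... | no _     | no _    = *-comm x z

    scale = permutation (x *_) (x⁻¹ *_)
      (λ z → trans (sym (*-assoc x x⁻¹ z)) (trans (cong (_* z) (trans (*-comm x x⁻¹) x⁻¹x≡1)) (*-identityˡ z)))
      (λ z → trans (sym (*-assoc x⁻¹ x z)) (trans (cong (_* z) x⁻¹x≡1) (*-identityˡ z)))

    product-off0 : product off0 ≡ 1#
    product-off0 = *-cancelˡ-≢0 (product-≢0 unit unit-≢0) (begin
      product unit * product off0          ≡⟨ Π.∑-distrib-+ unit off0 ⟨
      product (λ z → unit z * off0 z)      ≡⟨ Π.sum-cong-≗ unit-* ⟨
      product (λ z → unit (x * z))          ≡⟨ Π.sum-permute unit scale ⟨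
      product unit                          ≡⟨ *-identityʳ _ ⟨
      product unit * 1#                     ∎)

  -- The multiple of 1 by p ^ k is the k-th power of `p • 1#`, and it vanishes because the
  -- cardinality annihilates 1; a field has no nilpotent elements.
  characteristic : ∀ p k → n ≡ p ℕ.^ k → p • 1# ≡ 0#
  characteristic p k n≡pᵏ = ^≡0⇒≡0 k (trans (sym (^• k)) (trans (cong (_• 1#) (sym n≡pᵏ)) cardinality•1≡0))
    where
    open Mult semiring using (×1-homo-*)
    ^• : ∀ k → (p ℕ.^ k) • 1# ≡ (p • 1#) ^ k
    ^• zero    = +-identityʳ 1#
    ^• (suc k) = trans (×1-homo-* p (p ℕ.^ k)) (cong (p • 1# *_) (^• k))

-- A copy of the prime field that computes by pattern matching. It indexes the values of the trace
-- and supplies the coefficients of the ring solver.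
data 𝔽₃ : Set where
  𝟘 𝟙 -𝟙 : 𝔽₃

infixl 6 _+₃_
infixl 7 _*₃_

_+₃_ _*₃_ : 𝔽₃ → 𝔽₃ → 𝔽₃
𝟘  +₃ j  = j
𝟙  +₃ 𝟘  = 𝟙
𝟙  +₃ 𝟙  = -𝟙
𝟙  +₃ -𝟙 = 𝟘
-𝟙 +₃ 𝟘  = -𝟙
-𝟙 +₃ 𝟙  = 𝟘
-𝟙 +₃ -𝟙 = 𝟙

-₃_ : 𝔽₃ → 𝔽₃
-₃ 𝟘  = 𝟘
-₃ 𝟙  = -𝟙
-₃ -𝟙 = 𝟙

𝟘  *₃ j = 𝟘
𝟙  *₃ j = j
-𝟙 *₃ j = -₃ j

𝔽₃-rawRing : RawRing 0ℓ 0ℓ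
𝔽₃-rawRing = record { Carrier = 𝔽₃ ; _≈_ = _≡_ ; _+_ = _+₃_ ; _*_ = _*₃_ ; -_ = -₃_ ; 0# = 𝟘 ; 1# = 𝟙 }

module TernarySums where

  open ≡ using (refl; sym; trans)

  ∑₃ : (𝔽₃ → ℕ) → ℕ
  ∑₃ g = g 𝟘 ℕ.+ g 𝟙 ℕ.+ g -𝟙

  ∑₃-∑ : ∀ {n} (f : 𝔽₃ → Fin n → ℕ) → ∑₃ (λ j → ∑ (f j)) ≡ ∑ (λ x → ∑₃ (λ j → f j x))
  ∑₃-∑ f = sym (trans (∑-+ (λ x → f 𝟘 x ℕ.+ f 𝟙 x) (f -𝟙)) (cong (ℕ._+ ∑ (f -𝟙)) (∑-+ (f 𝟘) (f 𝟙))))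

  ∑₃-cong : {f g : 𝔽₃ → ℕ} → (∀ j → f j ≡ g j) → ∑₃ f ≡ ∑₃ g
  ∑₃-cong f≡g = cong₂ ℕ._+_ (cong₂ ℕ._+_ (f≡g 𝟘) (f≡g 𝟙)) (f≡g -𝟙)

  ∑₃-squeeze : ∀ (f : 𝔽₃ → ℕ) b → (∀ j → f j ≤ b) → ∑₃ f ≡ 3 ℕ.* b → ∀ j → f j ≡ b
  ∑₃-squeeze f b f≤b ∑₃f≡3b = λ
    { 𝟘  → ∑-squeeze g (λ _ → b) g≤b 3b≤∑g zero
    ; 𝟙  → ∑-squeeze g (λ _ → b) g≤b 3b≤∑g (suc zero)
    ; -𝟙 → ∑-squeeze g (λ _ → b) g≤b 3b≤∑g (suc (suc zero)) }
    where
    associate : ∀ x y z → x ℕ.+ y ℕ.+ z ≡ x ℕ.+ (y ℕ.+ (z ℕ.+ 0))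
    associate = ℕ-Solver.solve-∀
    value : Fin 3 → 𝔽₃
    value zero             = 𝟘
    value (suc zero)       = 𝟙
    value (suc (suc zero)) = -𝟙
    g : Fin 3 → ℕ
    g = f ∘ value
    g≤b : ∀ i → g i ≤ b
    g≤b = f≤b ∘ value
    3b≤∑g : ∑ {3} (λ _ → b) ≤ ∑ g
    3b≤∑g = ℕ.≤-reflexive (trans (∑-const 3 b) (trans (sym ∑₃f≡3b)
      (associate (f 𝟘) (f 𝟙) (f -𝟙))))

open TernarySums

-- Characteristic 3: ring solver, polynomial functions and their roots.

module CharacteristicThree {n : ℕ} (K : FiniteField n)
       (3•1≡0 : FiniteField._•_ K 3 (FiniteField.1# K) ≡ FiniteField.0# K) where

  open ≡ using (refl; sym; trans)
  open FiniteField K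
  open FiniteFieldProperties K public
  open RingProperties (CommutativeRing.ring commutativeRing) using (-0#≈0#; -‿involutive; -1*x≈-x)
  open AbelianGroupProperties (CommutativeRing.+-abelianGroup commutativeRing) using (inverseʳ-unique)

  embed : 𝔽₃ → Fin n
  embed 𝟘  = 0#
  embed 𝟙  = 1#
  embed -𝟙 = - 1#

  1+1≡-1 : 1# + 1# ≡ - 1#
  1+1≡-1 = inverseʳ-unique 1# (1# + 1#) (trans (cong (λ x → 1# + (1# + x)) (sym (+-identityʳ 1#))) 3•1≡0)

  -1-1≡1 : - 1# + - 1# ≡ 1#
  -1-1≡1 = begin
    - 1# + - 1#        ≡⟨ cong (- 1# +_) 1+1≡-1 ⟨
    - 1# + (1# + 1#)   ≡⟨ +-assoc (- 1#) 1# 1# ⟨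
    - 1# + 1# + 1#     ≡⟨ cong (_+ 1#) (-‿inverseˡ 1#) ⟩
    0# + 1#            ≡⟨ +-identityˡ 1# ⟩
    1#                 ∎
    where open ≡-Reasoning

  embed-+ : ∀ i j → embed (i +₃ j) ≡ embed i + embed j
  embed-+ 𝟘  j  = sym (+-identityˡ _)
  embed-+ 𝟙  𝟘  = sym (+-identityʳ _)
  embed-+ 𝟙  𝟙  = sym 1+1≡-1
  embed-+ 𝟙  -𝟙 = sym (-‿inverseʳ 1#)
  embed-+ -𝟙 𝟘  = sym (+-identityʳ _)
  embed-+ -𝟙 𝟙  = sym (-‿inverseˡ 1#)
  embed-+ -𝟙 -𝟙 = sym -1-1≡1

  embed-neg : ∀ j → embed (-₃ j) ≡ - embed j
  embed-neg 𝟘  = sym -0#≈0#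
  embed-neg 𝟙  = refl
  embed-neg -𝟙 = sym (-‿involutive 1#)

  embed-* : ∀ i j → embed (i *₃ j) ≡ embed i * embed j
  embed-* 𝟘  j = sym (zeroˡ _)
  embed-* 𝟙  j = sym (*-identityˡ _)
  embed-* -𝟙 j = trans (embed-neg j) (sym (-1*x≈-x (embed j)))

  private
    almostCommutativeRing : AlmostCommutativeRing 0ℓ 0ℓ
    almostCommutativeRing = fromCommutativeRing commutativeRing

    embed-morphism : 𝔽₃-rawRing -Raw-AlmostCommutative⟶ almostCommutativeRing
    embed-morphism = record
      { ⟦_⟧ = embed ; +-homo = embed-+ ; *-homo = embed-* ; -‿homo = embed-neg ; 0-homo = refl ; 1-homo = refl }

    embed-≟ : ∀ i j → Maybe (embed i ≡ embed j)
    embed-≟ 𝟘  𝟘  = just refl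
    embed-≟ 𝟙  𝟙  = just refl
    embed-≟ -𝟙 -𝟙 = just refl
    embed-≟ _  _  = nothing

  -- With coefficients in 𝔽₃ the ring solver knows that the characteristic is 3.
  open RingSolver 𝔽₃-rawRing almostCommutativeRing embed-morphism embed-≟ public
    using (solve; con; _:+_; _:*_; :-_; _:-_; _:=_; _:^_)

  x-y≡0⇒x≡y : ∀ {x y} → x - y ≡ 0# → x ≡ y
  x-y≡0⇒x≡y {x} {y} x-y≡0 = trans (solve 2 (λ x y → x := x :- y :+ y) refl x y) (trans (cong (_+ y) x-y≡0) (+-identityˡ y))

  -- Poly a k f says that f is a polynomial function a xᵏ + lower terms.
  data Poly (a : Fin n) : ℕ → (Fin n → Fin n) → Set where
    constant : ∀ {f} → (∀ x → f x ≡ a) → Poly a 0 f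
    horner   : ∀ {k f g} c → Poly a k g → (∀ x → f x ≡ x * g x + c) → Poly a (suc k) f

  -- The index of `Poly` is only a formal degree: a zero top coefficient is allowed, so that
  -- polynomials of different degrees can be added.
  Poly-raise : ∀ {a k f} → Poly a k f → Poly 0# (suc k) f
  Poly-raise {a} (constant f≡a) = horner a (constant {f = λ _ → 0#} (λ _ → refl))
    (λ x → trans (f≡a x) (solve 2 (λ a x → a := x :* con 𝟘 :+ a) refl a x))
  Poly-raise (horner c g f≡) = horner c (Poly-raise g) f≡

  Poly-lower : ∀ {a k l f} → suc k ≤′ l → Poly a k f → Poly 0# l f
  Poly-lower ≤′-refl       p = Poly-raise p
  Poly-lower (≤′-step k<l) p = Poly-raise (Poly-lower k<l p)

  Poly-+ : ∀ {a b k f g} → Poly a k f → Poly b k g → Poly (a + b) k (λ x → f x + g x)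
  Poly-+ (constant f≡a) (constant g≡b) = constant (λ x → cong₂ _+_ (f≡a x) (g≡b x))
  Poly-+ (horner {g = f′} c p f≡) (horner {g = g′} e q g≡) = horner (c + e) (Poly-+ p q) (λ x →
    trans (cong₂ _+_ (f≡ x) (g≡ x))
      (solve 5 (λ x f g c e → x :* f :+ c :+ (x :* g :+ e) := x :* (f :+ g) :+ (c :+ e)) refl x (f′ x) (g′ x) c e))

  Poly-+-lower : ∀ {a k f g} → Poly a k f → Poly 0# k g → Poly a k (λ x → f x + g x)
  Poly-+-lower {a} {k} {f} {g} p q = subst (λ b → Poly b k (λ x → f x + g x)) (+-identityʳ a) (Poly-+ p q)

  Poly-scale : ∀ {a k f} b → Poly a k f → Poly (b * a) k (λ x → b * f x)
  Poly-scale b (constant f≡a) = constant (λ x → cong (b *_) (f≡a x))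
  Poly-scale b (horner {g = g} c p f≡) = horner (b * c) (Poly-scale b p) (λ x →
    trans (cong (b *_) (f≡ x)) (solve 4 (λ b x g c → b :* (x :* g :+ c) := x :* (b :* g) :+ b :* c) refl b x (g x) c))

  Poly-shift : ∀ {a k f} → Poly a k f → Poly a (suc k) (λ x → x * f x)
  Poly-shift p = horner 0# p (λ x → sym (+-identityʳ _))

  Poly-const : ∀ c → Poly c 0 (λ _ → c)
  Poly-const c = constant (λ _ → refl)

  Poly-id : Poly 1# 1 id
  Poly-id = horner 0# (Poly-const 1#) (λ x → solve 1 (λ x → x := x :* con 𝟙 :+ con 𝟘) refl x)

  -- In the Horner scheme every multiplication by x becomes three of them.
  Poly-∘-cube : ∀ {a k f} → Poly a k f → Poly a (k ℕ.* 3) (λ x → f (x ^ 3))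
  Poly-∘-cube (constant f≡a) = constant (λ x → f≡a (x ^ 3))
  Poly-∘-cube (horner {g = g} c p f≡) = horner c (Poly-shift (Poly-shift (Poly-∘-cube p))) (λ x →
    trans (f≡ (x ^ 3)) (solve 3 (λ x g c → x :^ 3 :* g :+ c := x :* (x :* (x :* g)) :+ c) refl x (g (x ^ 3)) c))

  -- Synthetic division: if f = X h + c and h = (X - r) g + h r, then f = (X - r) (h + r g) + f r.
  -- The summand r g has smaller degree than h, so the leading coefficient stays `a`.
  Poly-divide : ∀ {a k f} → Poly a (suc k) f → ∀ r →
    ∃[ g ] Poly a k g × (∀ x → f x ≡ (x - r) * g x + f r)
  Poly-divide {a} {f = f} (horner {g = h} c (constant h≡a) f≡) r = h , constant h≡a , λ x → begin
    f x                              ≡⟨ f≡ x ⟩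
    x * h x + c                      ≡⟨ cong (λ y → x * y + c) (h≡a x) ⟩
    x * a + c                        ≡⟨ solve 4 (λ x r a c → x :* a :+ c := (x :- r) :* a :+ (r :* a :+ c)) refl x r a c ⟩
    (x - r) * a + (r * a + c)        ≡⟨ cong₂ (λ y z → (x - r) * y + (r * z + c)) (h≡a x) (h≡a r) ⟨
    (x - r) * h x + (r * h r + c)    ≡⟨ cong ((x - r) * h x +_) (f≡ r) ⟨
    (x - r) * h x + f r              ∎
    where open ≡-Reasoning
  Poly-divide {f = f} (horner {g = h} c p@(horner _ _ _) f≡) r
    with g , q , h≡ ← Poly-divide p r =
    (λ x → h x + r * g x) , Poly-+-lower p (Poly-raise (Poly-scale r q)) , λ x → begin
    f x                                                ≡⟨ f≡ x ⟩
    x * h x + c                                        ≡⟨ solve 5 (λ x r c hx hr → x :* hx :+ c := (x :- r) :* hx :+ (r :* (hx :- hr) :+ (r :* hr :+ c))) refl x r c (h x) (h r) ⟩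
    (x - r) * h x + (r * (h x - h r) + (r * h r + c))  ≡⟨ cong₂ (λ y z → (x - r) * h x + (r * (y - h r) + z)) (h≡ x) (sym (f≡ r)) ⟩
    (x - r) * h x + (r * ((x - r) * g x + h r - h r) + f r)
      ≡⟨ solve 6 (λ x r hx hr gx fr → (x :- r) :* hx :+ (r :* ((x :- r) :* gx :+ hr :- hr) :+ fr) := (x :- r) :* (hx :+ r :* gx) :+ fr) refl x r (h x) (h r) (g x) (f r) ⟩
    (x - r) * (h x + r * g x) + f r                    ∎
    where open ≡-Reasoning

  quotient-≡ : ∀ {f g : Fin n → Fin n} {r} → (∀ x → f x ≡ (x - r) * g x + f r) → f r ≡ 0# → ∀ x → f x ≡ (x - r) * g x
  quotient-≡ {g = g} {r} f≡ fr≡0 x = trans (f≡ x) (trans (cong ((x - r) * g x +_) fr≡0) (+-identityʳ _))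

  quotient-root : ∀ {f g : Fin n → Fin n} {r} → (∀ x → f x ≡ (x - r) * g x + f r) → f r ≡ 0# →
                  ∀ {s} → r ≢ s × f s ≡ 0# → g s ≡ 0#
  quotient-root f≡ fr≡0 {s} (r≢s , fs≡0) with *≡0⇒≡0 (trans (sym (quotient-≡ f≡ fr≡0 s)) fs≡0)
  ... | inj₁ s-r≡0 = contradiction (sym (x-y≡0⇒x≡y s-r≡0)) r≢s
  ... | inj₂ gs≡0  = gs≡0

  product : List (Fin n) → Fin n
  product = foldr _*_ 1#

  -- Splitting off one root leaves the others as roots of the quotient, since they are distinct. The
  -- cofactor and its leading coefficient are retained, not merely the bound on the number of roots,
  -- because `even-nonsquares` needs a complete factorisation.
  Poly-factor : ∀ {a k f} → a ≢ 0# → Poly a k f → (rs : List (Fin n)) → Unique rs → All (λ r → f r ≡ 0#) rs →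
    ∃[ j ] k ≡ length rs ℕ.+ j × ∃[ g ] Poly a j g × (∀ x → f x ≡ product (List.map (λ r → x - r) rs) * g x)
  Poly-factor {k = k} {f} a≢0 p [] _ _ = k , refl , f , p , λ x → sym (*-identityˡ (f x))
  Poly-factor a≢0 (constant f≡a) (r ∷ rs) _ (fr≡0 ∷ _) = contradiction (trans (sym (f≡a r)) fr≡0) a≢0
  Poly-factor {f = f} a≢0 p@(horner _ _ _) (r ∷ rs) (r∉rs ∷ rs!) (fr≡0 ∷ frs≡0)
    with g , q , f≡ ← Poly-divide p r
    with j , k≡ , h , s , g≡ ← Poly-factor a≢0 q rs rs! (All.zipWith (quotient-root f≡ fr≡0) (r∉rs , frs≡0))
    = j , cong suc k≡ , h , s , λ x → begin
      f x                                                ≡⟨ quotient-≡ f≡ fr≡0 x ⟩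
      (x - r) * g x                                      ≡⟨ cong ((x - r) *_) (g≡ x) ⟩
      (x - r) * (product (List.map (λ r → x - r) rs) * h x)     ≡⟨ *-assoc (x - r) _ _ ⟨
      product (List.map (λ r → x - r) (r ∷ rs)) * h x           ∎
    where open ≡-Reasoning

  roots : (Fin n → Fin n) → Fin n → List (Fin n)
  roots f t = filter (λ x → f x ≟ t) (allFin n)

  length-roots : ∀ f t → length (roots f t) ≡ fibre f t
  length-roots f t = length-filter-tabulate (λ x → f x ≟ t) id

  -- Subtracting the constant `t` keeps the leading coefficient because the degree is at least 1.
  Poly-factor-roots : ∀ {a k f} → a ≢ 0# → Poly a k f → ∀ t → suc 0 ≤ k →
    ∃[ j ] k ≡ fibre f t ℕ.+ j × ∃[ g ] Poly a j g × (∀ x → f x - t ≡ product (List.map (λ r → x - r) (roots f t)) * g x)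
  Poly-factor-roots {f = f} a≢0 p t 1≤k
    with j , k≡ , rest ← Poly-factor a≢0 (Poly-+-lower p (Poly-lower (ℕ.≤⇒≤′ 1≤k) (Poly-const (- t)))) (roots f t)
           (Unique.filter⁺ (λ x → f x ≟ t) (Unique.allFin⁺ n))
           (All.map (λ {r} fr≡t → trans (cong (_- t) fr≡t) (-‿inverseʳ t)) (All.all-filter (λ x → f x ≟ t) (allFin n)))
    = j , trans k≡ (cong (ℕ._+ j) (length-roots f t)) , rest

  fibre-Poly : ∀ {a k f} → a ≢ 0# → Poly a k f → suc 0 ≤ k → ∀ t → fibre f t ≤ k
  fibre-Poly a≢0 p 1≤k t with j , refl , _ ← Poly-factor-roots a≢0 p t 1≤k = ℕ.m≤m+n _ j

-- The trace to the prime field and additive Hilbert 90, with q = 3 ^ (m + 1).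

module TernaryField {m : ℕ} (K : FiniteField (3 ℕ.^ suc m)) where

  open ≡ using (refl; sym; trans)
  open FiniteField K public
  open CharacteristicThree K (FiniteFieldProperties.characteristic K 3 (suc m) refl) public
  open Exp semiring using (^-assocʳ)

  private
    q : ℕ
    q = 3 ℕ.^ suc m

  1≢0 : 1# ≢ 0#
  1≢0 = 0≢1 ∘ sym

  -1≢0 : - 1# ≢ 0#
  -1≢0 -1≡0 = 0≢1 (trans (solve 0 (con 𝟘 := :- con 𝟘) refl) (trans (cong -_ (sym -1≡0)) (solve 0 (:- (:- con 𝟙) := con 𝟙) refl)))

  1≢-1 : 1# ≢ - 1#
  1≢-1 1≡-1 = -1≢0 (trans (solve 0 (:- con 𝟙 := con 𝟙 :- (:- con 𝟙)) refl) (trans (cong (_- - 1#) 1≡-1) (-‿inverseʳ (- 1#))))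

  embed-injective : ∀ {i j} → embed i ≡ embed j → i ≡ j
  embed-injective {𝟘}  {𝟘}  _ = refl
  embed-injective {𝟘}  {𝟙}  e = contradiction e 0≢1
  embed-injective {𝟘}  { -𝟙} e = contradiction (sym e) -1≢0
  embed-injective {𝟙}  {𝟘}  e = contradiction e 1≢0
  embed-injective {𝟙}  {𝟙}  _ = refl
  embed-injective {𝟙}  { -𝟙} e = contradiction e 1≢-1
  embed-injective { -𝟙} {𝟘}  e = contradiction e -1≢0
  embed-injective { -𝟙} {𝟙}  e = contradiction (sym e) 1≢-1
  embed-injective { -𝟙} { -𝟙} _ = refl

  -- The sum of x ^ (3 ^ i) for i < k, arranged so that the recursion cubes the argument; inductions
  -- then use only that cubing is additive.
  Trace : ℕ → Fin q → Fin q
  Trace zero    x = 0#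
  Trace (suc k) x = Trace k (x ^ 3) + x

  Trace-+ : ∀ k x y → Trace k (x + y) ≡ Trace k x + Trace k y
  Trace-+ zero    x y = sym (+-identityʳ 0#)
  Trace-+ (suc k) x y = begin
    Trace k ((x + y) ^ 3) + (x + y)                ≡⟨ cong (λ z → Trace k z + (x + y)) (solve 2 (λ x y → (x :+ y) :^ 3 := x :^ 3 :+ y :^ 3) refl x y) ⟩
    Trace k (x ^ 3 + y ^ 3) + (x + y)              ≡⟨ cong (_+ (x + y)) (Trace-+ k (x ^ 3) (y ^ 3)) ⟩
    Trace k (x ^ 3) + Trace k (y ^ 3) + (x + y)    ≡⟨ solve 4 (λ a b x y → a :+ b :+ (x :+ y) := a :+ x :+ (b :+ y)) refl _ _ x y ⟩
    Trace (suc k) x + Trace (suc k) y              ∎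
    where open ≡-Reasoning

  Trace-cube : ∀ k x → Trace k x ^ 3 ≡ Trace k (x ^ 3)
  Trace-cube zero    x = solve 0 (con 𝟘 :^ 3 := con 𝟘) refl
  Trace-cube (suc k) x = trans (solve 2 (λ a b → (a :+ b) :^ 3 := a :^ 3 :+ b :^ 3) refl (Trace k (x ^ 3)) x)
    (cong (_+ x ^ 3) (Trace-cube k (x ^ 3)))

  -- Both sides are the sum of x ^ (3 ^ i) over 0 ≤ i ≤ k, with the first or the last conjugate set
  -- apart. For k = m + 1 the last one is x ^ q = x, which makes `T` invariant under cubing.
  Trace-last : ∀ k x → Trace k (x ^ 3) + x ≡ Trace k x + x ^ (3 ℕ.^ k)
  Trace-last zero    x = cong (0# +_) (sym (*-identityʳ x))
  Trace-last (suc k) x = begin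
    Trace k ((x ^ 3) ^ 3) + x ^ 3 + x                  ≡⟨ cong (_+ x) (Trace-last k (x ^ 3)) ⟩
    Trace k (x ^ 3) + (x ^ 3) ^ (3 ℕ.^ k) + x          ≡⟨ solve 3 (λ a b c → a :+ b :+ c := a :+ c :+ b) refl _ _ _ ⟩
    Trace k (x ^ 3) + x + (x ^ 3) ^ (3 ℕ.^ k)          ≡⟨ cong (Trace (suc k) x +_) (^-assocʳ x 3 (3 ℕ.^ k)) ⟩
    Trace (suc k) x + x ^ (3 ℕ.^ suc k)                ∎
    where open ≡-Reasoning

  -- For `T` the degree is q / 3, exactly the average size of a fibre over three possible values;
  -- this is why the degree bound is sharp in `fibre-T`.
  Trace-Poly : ∀ k → Poly 1# (3 ℕ.^ k) (Trace (suc k))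
  Trace-Poly zero    = horner 0# (Poly-const 1#) (λ x → solve 1 (λ x → con 𝟘 :+ x := x :* con 𝟙 :+ con 𝟘) refl x)
  Trace-Poly (suc k) = Poly-+-lower
    (subst (λ l → Poly 1# l (Trace (suc k) ∘ (_^ 3))) (ℕ.*-comm (3 ℕ.^ k) 3) (Poly-∘-cube (Trace-Poly k)))
    (Poly-lower (ℕ.≤⇒≤′ (ℕ.≤-trans (ℕ.n≤1+n 2) (ℕ.m≤m*n 3 (3 ℕ.^ k) {{ℕ.m^n≢0 3 k}}))) Poly-id)

  T : Fin q → Fin q
  T = Trace (suc m)

  T-+ : ∀ x y → T (x + y) ≡ T x + T y
  T-+ = Trace-+ (suc m)

  T-0 : T 0# ≡ 0#
  T-0 = trans (solve 1 (λ t → t := t :+ t :- t) refl (T 0#)) (trans (cong (_- T 0#) (trans (sym (T-+ 0# 0#)) (cong T (+-identityʳ 0#)))) (-‿inverseʳ (T 0#)))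

  T-neg : ∀ x → T (- x) ≡ - T x
  T-neg x = trans (solve 2 (λ a b → a := b :+ a :- b) refl (T (- x)) (T x))
    (trans (cong (_- T x) (trans (sym (T-+ x (- x))) (trans (cong T (-‿inverseʳ x)) T-0))) (+-identityˡ _))

  T-sub : ∀ x y → T (x - y) ≡ T x - T y
  T-sub x y = trans (T-+ x (- y)) (cong (T x +_) (T-neg y))

  T-cube : ∀ x → T (x ^ 3) ≡ T x
  T-cube x = trans (solve 2 (λ a x → a := a :+ x :- x) refl (T (x ^ 3)) x)
    (trans (cong (_- x) (trans (Trace-last (suc m) x) (cong (T x +_) x^q≡x))) (solve 2 (λ a x → a :+ x :- x := a) refl (T x) x))
    where
    x^q≡x : x ^ q ≡ x
    x^q≡x with x ≟ 0#
    ... | no x≢0   = fermat x x≢0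
    -- `fermat` covers only nonzero elements; for 0 the exponent is exposed as a successor, so that
    -- the power contains a factor 0.
    ... | yes refl = trans (cong (0# ^_) (sym (ℕ.suc-pred q {{ℕ.m^n≢0 3 (suc m)}}))) (zeroˡ _)

  -- The element `T x` is fixed by cubing, hence a root of t³ - t = t (t - 1) (t + 1).
  trace : ∀ x → ∃[ j ] T x ≡ embed j
  trace x = [ (λ t≡0 → 𝟘 , t≡0)
            , (λ e → [ (λ t-1≡0 → 𝟙 , x-y≡0⇒x≡y t-1≡0) , (λ t+1≡0 → -𝟙 , x-y≡0⇒x≡y t+1≡0) ]′ (*≡0⇒≡0 e))
            ]′ (*≡0⇒≡0 t[t-1][t+1]≡0)
    where
    open ≡-Reasoning
    t[t-1][t+1]≡0 : T x * ((T x - 1#) * (T x - - 1#)) ≡ 0#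
    t[t-1][t+1]≡0 = begin
      T x * ((T x - 1#) * (T x - - 1#))  ≡⟨ solve 1 (λ t → t :* ((t :- con 𝟙) :* (t :- (:- con 𝟙))) := t :^ 3 :- t) refl (T x) ⟩
      T x ^ 3 - T x                      ≡⟨ cong (_- T x) (trans (Trace-cube (suc m) x) (T-cube x)) ⟩
      T x - T x                          ≡⟨ -‿inverseʳ (T x) ⟩
      0#                                 ∎

  ∑₃-δ : ∀ x (g : 𝔽₃ → ℕ) {j} → T x ≡ embed j → ∑₃ (λ i → ⟦ T x ≟ embed i ⟧ ℕ.* g i) ≡ g j
  ∑₃-δ x g {j} Tx≡j = trans (∑₃-cong (λ i → cong (λ t → ⟦ t ≟ embed i ⟧ ℕ.* g i) Tx≡j)) (lemma j)
    where
    open ≡-Reasoning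
    δ : ∀ j i → ℕ
    δ j i = ⟦ embed j ≟ embed i ⟧ ℕ.* g i
    δ-diag : ∀ j → δ j j ≡ g j
    δ-diag j = trans (cong (ℕ._* g j) (⟦⟧-yes (embed j ≟ embed j) refl)) (ℕ.*-identityˡ (g j))
    δ-off : ∀ j i → j ≢ i → δ j i ≡ 0
    δ-off j i j≢i = cong (ℕ._* g i) (⟦⟧-no (embed j ≟ embed i) (j≢i ∘ embed-injective))
    lemma : ∀ j → ∑₃ (δ j) ≡ g j
    lemma 𝟘  = trans (cong₂ ℕ._+_ (cong₂ ℕ._+_ (δ-diag 𝟘) (δ-off 𝟘 𝟙 λ ())) (δ-off 𝟘 -𝟙 λ ())) (trans (ℕ.+-identityʳ _) (ℕ.+-identityʳ _))
    lemma 𝟙  = trans (cong₂ ℕ._+_ (cong₂ ℕ._+_ (δ-off 𝟙 𝟘 λ ()) (δ-diag 𝟙)) (δ-off 𝟙 -𝟙 λ ())) (ℕ.+-identityʳ _)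
    lemma -𝟙 = cong₂ ℕ._+_ (cong₂ ℕ._+_ (δ-off -𝟙 𝟘 λ ()) (δ-off -𝟙 𝟙 λ ())) (δ-diag -𝟙)

  ∑₃-⟦T⟧ : ∀ x → ∑₃ (λ i → ⟦ T x ≟ embed i ⟧) ≡ 1
  ∑₃-⟦T⟧ x = let j , Tx≡j = trace x in
    trans (∑₃-cong {λ i → ⟦ T x ≟ embed i ⟧} (λ i → sym (ℕ.*-identityʳ _))) (∑₃-δ x (λ _ → 1) {j} Tx≡j)

  -- The fibres are zero sets of polynomials of degree 3ᵐ, and three of them cover the field.
  fibre-T : ∀ j → fibre T (embed j) ≡ 3 ℕ.^ m
  fibre-T = ∑₃-squeeze (fibre T ∘ embed) (3 ℕ.^ m)
    (λ j → fibre-Poly 1≢0 (Trace-Poly m) (ℕ.m^n>0 3 m) (embed j))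
    (begin
      ∑₃ (λ j → ∑ (λ x → ⟦ T x ≟ embed j ⟧))    ≡⟨ ∑₃-∑ (λ j x → ⟦ T x ≟ embed j ⟧) ⟩
      ∑ (λ x → ∑₃ (λ j → ⟦ T x ≟ embed j ⟧))    ≡⟨ ∑-cong ∑₃-⟦T⟧ ⟩
      ∑ {q} (λ _ → 1)                           ≡⟨ trans (∑-const q 1) (ℕ.*-identityʳ q) ⟩
      q                                         ∎)
    where open ≡-Reasoning

  -- The Artin-Schreier map; its image is the kernel of the trace.
  ℘ : Fin q → Fin q
  ℘ x = x ^ 3 - x

  -- Additive Hilbert 90, by counting: the bound ≤ is clear, and both sides sum to q.
  fibre-℘ : ∀ z → fibre ℘ z ≡ 3 ℕ.* ⟦ T z ≟ 0# ⟧
  fibre-℘ = ∑-squeeze (fibre ℘) _ bound (ℕ.≤-reflexive (begin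
    ∑ (λ z → 3 ℕ.* ⟦ T z ≟ 0# ⟧)    ≡⟨ ∑-*ˡ 3 (λ z → ⟦ T z ≟ 0# ⟧) ⟨
    3 ℕ.* fibre T 0#                ≡⟨ cong (3 ℕ.*_) (fibre-T 𝟘) ⟩
    q                               ≡⟨ ∑-fibre ℘ ⟨
    ∑ (fibre ℘)                     ∎))
    where
    open ≡-Reasoning
    ℘-Poly : Poly 1# 3 ℘
    ℘-Poly = horner 0# (horner (- 1#) Poly-id (λ _ → refl))
      (λ x → solve 1 (λ x → x :^ 3 :- x := x :* (x :* x :+ (:- con 𝟙)) :+ con 𝟘) refl x)
    bound : ∀ z → fibre ℘ z ≤ 3 ℕ.* ⟦ T z ≟ 0# ⟧
    bound z with T z ≟ 0#
    ... | yes _    = fibre-Poly 1≢0 ℘-Poly (s≤s z≤n) z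
    ... | no Tz≢0 = ℕ.≤-reflexive (trans (∑-cong (λ x → ⟦⟧-no (℘ x ≟ z) (λ { refl →
      Tz≢0 (trans (T-sub (x ^ 3) x) (trans (cong (_- T x) (T-cube x)) (-‿inverseʳ (T x)))) }))) (trans (∑-const q 0) (ℕ.*-zeroʳ q)))

-- Squares and nonsquares, and the parity of nonsquares of trace 1.

module Squares {m : ℕ} (K : FiniteField (3 ℕ.^ suc m)) where

  open ≡ using (refl; sym; trans)
  open TernaryField {m} K

  private
    q : ℕ
    q = 3 ℕ.^ suc m

  -- Zero counts as a square here, in contrast to `IsNonzeroSquare`; cancellation therefore asks for
  -- a nonzero factor.
  IsSquare : Fin q → Set
  IsSquare z = ∃[ y ] y ^ 2 ≡ z

  isSquare? : Decidable IsSquare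
  isSquare? z = any? (λ y → y ^ 2 ≟ z)

  square-* : ∀ {x y} → IsSquare x → IsSquare y → IsSquare (x * y)
  square-* (u , refl) (v , refl) = u * v , solve 2 (λ u v → (u :* v) :^ 2 := u :^ 2 :* v :^ 2) refl u v

  square-cancel : ∀ {x y} → x ≢ 0# → IsSquare x → IsSquare (x * y) → IsSquare y
  square-cancel {y = y} x≢0 (u , refl) (v , v²≡u²y) with u⁻¹ , u⁻¹u≡1 ← inverse u (λ { refl → x≢0 (zeroˡ _) }) =
    u⁻¹ * v , (begin
      (u⁻¹ * v) ^ 2          ≡⟨ solve 2 (λ i v → (i :* v) :^ 2 := i :^ 2 :* v :^ 2) refl u⁻¹ v ⟩
      u⁻¹ ^ 2 * v ^ 2        ≡⟨ cong (u⁻¹ ^ 2 *_) v²≡u²y ⟩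
      u⁻¹ ^ 2 * (u ^ 2 * y)  ≡⟨ solve 3 (λ i u y → i :^ 2 :* (u :^ 2 :* y) := (i :* u) :^ 2 :* y) refl u⁻¹ u y ⟩
      (u⁻¹ * u) ^ 2 * y      ≡⟨ cong (λ e → e ^ 2 * y) u⁻¹u≡1 ⟩
      1# ^ 2 * y             ≡⟨ solve 1 (λ y → con 𝟙 :^ 2 :* y := y) refl y ⟩
      y                      ∎)
    where open ≡-Reasoning

  0-square : IsSquare 0#
  0-square = 0# , zeroˡ _

  1-square : IsSquare 1#
  1-square = 1# , solve 0 (con 𝟙 :^ 2 := con 𝟙) refl

  nonsquare⇒≢0 : ∀ {g} → ¬ IsSquare g → g ≢ 0#
  nonsquare⇒≢0 ¬sq refl = ¬sq 0-square

  fibre-nonsquare : ∀ {z} → ¬ IsSquare z → fibre (_^ 2) z ≡ 0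
  fibre-nonsquare {z} ¬sq = trans (∑-cong (λ y → ⟦⟧-no (y ^ 2 ≟ z) (λ e → ¬sq (y , e)))) (trans (∑-const q 0) (ℕ.*-zeroʳ q))

  fibre-square-≤2 : ∀ z → fibre (_^ 2) z ≤ 2
  fibre-square-≤2 = fibre-Poly 1≢0
    (horner 0# Poly-id (λ x → solve 1 (λ x → x :^ 2 := x :* x :+ con 𝟘) refl x)) (s≤s z≤n)

  fibre-square-0 : fibre (_^ 2) 0# ≡ 1
  fibre-square-0 = trans
    (∑-cong (λ y → ⟦⟧-cong (y ^ 2 ≟ 0#) (0# ≟ y) (sym ∘ ^≡0⇒≡0 2) (λ { refl → zeroˡ _ }))) (∑-⟦≟⟧ 0#)

  x≢-x : ∀ {x} → x ≢ 0# → x ≢ - x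
  x≢-x {x} x≢0 x≡-x = x≢0 (begin
    -- In characteristic 3 the element x equals -2 x.
    x              ≡⟨ solve 1 (λ x → x := (:- x) :- x) refl x ⟩
    - x - x        ≡⟨ cong (_- x) (sym x≡-x) ⟩
    x - x          ≡⟨ -‿inverseʳ x ⟩
    0#             ∎)
    where open ≡-Reasoning

  -- The degree allows at most two roots, and u and -u are two distinct ones.
  fibre-square : ∀ {z} → z ≢ 0# → IsSquare z → fibre (_^ 2) z ≡ 2
  fibre-square z≢0 (u , refl) = ℕ.≤-antisym (fibre-square-≤2 (u ^ 2)) (begin
    2                                                       ≡⟨ cong₂ ℕ._+_ (∑-⟦≟⟧ u) (∑-⟦≟⟧ (- u)) ⟨
    ∑ (λ y → ⟦ u ≟ y ⟧) ℕ.+ ∑ (λ y → ⟦ - u ≟ y ⟧)           ≡⟨ ∑-+ (λ y → ⟦ u ≟ y ⟧) (λ y → ⟦ - u ≟ y ⟧) ⟨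
    ∑ (λ y → ⟦ u ≟ y ⟧ ℕ.+ ⟦ - u ≟ y ⟧)                     ≤⟨ ∑-mono _ (λ y → ⟦ y ^ 2 ≟ u ^ 2 ⟧) root ⟩
    fibre (_^ 2) (u ^ 2)                                    ∎)
    where
    open ℕ.≤-Reasoning
    u≢0 : u ≢ 0#
    u≢0 refl = z≢0 (zeroˡ _)
    root : ∀ y → ⟦ u ≟ y ⟧ ℕ.+ ⟦ - u ≟ y ⟧ ≤ ⟦ y ^ 2 ≟ u ^ 2 ⟧
    root y with u ≟ y | - u ≟ y
    ... | yes refl | yes -u≡u = contradiction (sym -u≡u) (x≢-x u≢0)
    ... | yes refl | no _     = ℕ.≤-reflexive (sym (⟦⟧-yes (u ^ 2 ≟ u ^ 2) refl))
    ... | no _     | yes refl = ℕ.≤-reflexive (sym (⟦⟧-yes ((- u) ^ 2 ≟ u ^ 2) (solve 1 (λ u → (:- u) :^ 2 := u :^ 2) refl u)))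
    ... | no _     | no _     = z≤n

  -- For g a nonsquare and z ≠ 0, at most one of z and g z is a square; summing over z shows it is always exactly one.
  fibre-twist : ∀ {g} → ¬ IsSquare g → ∀ z → fibre (_^ 2) z ℕ.+ fibre (_^ 2) (g * z) ≡ 2
  fibre-twist {g} ¬sq = ∑-squeeze _ (λ _ → 2) bound (ℕ.≤-reflexive (begin
    ∑ {q} (λ _ → 2)                                                 ≡⟨ ∑-const q 2 ⟩
    q ℕ.* 2                                                         ≡⟨ ℕ.*-comm q 2 ⟩
    q ℕ.+ (q ℕ.+ 0)                                                 ≡⟨ cong (q ℕ.+_) (ℕ.+-identityʳ q) ⟩
    q ℕ.+ q                                                         ≡⟨ cong₂ ℕ._+_ (∑-fibre (_^ 2)) (∑-fibre (_^ 2)) ⟨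
    ∑ (fibre (_^ 2)) ℕ.+ ∑ (fibre (_^ 2))                           ≡⟨ cong (∑ (fibre (_^ 2)) ℕ.+_) (∑-injective (g *_) (*-cancelˡ-≢0 (nonsquare⇒≢0 ¬sq)) (fibre (_^ 2))) ⟨
    ∑ (fibre (_^ 2)) ℕ.+ ∑ (λ z → fibre (_^ 2) (g * z))             ≡⟨ ∑-+ (fibre (_^ 2)) (λ z → fibre (_^ 2) (g * z)) ⟨
    ∑ (λ z → fibre (_^ 2) z ℕ.+ fibre (_^ 2) (g * z))               ∎))
    where
    open ≡-Reasoning
    bound : ∀ z → fibre (_^ 2) z ℕ.+ fibre (_^ 2) (g * z) ≤ 2
    bound z = by-cases (z ≟ 0#) (isSquare? z)
      where
      by-cases : Dec (z ≡ 0#) → Dec (IsSquare z) → fibre (_^ 2) z ℕ.+ fibre (_^ 2) (g * z) ≤ 2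
      by-cases (yes z≡0) _ = ℕ.≤-reflexive (cong₂ ℕ._+_ (trans (cong (fibre (_^ 2)) z≡0) fibre-square-0)
        (trans (cong (fibre (_^ 2)) (trans (cong (g *_) z≡0) (zeroʳ g))) fibre-square-0))
      by-cases (no z≢0) (yes sq) = subst (λ f → fibre (_^ 2) z ℕ.+ f ≤ 2)
        (sym (fibre-nonsquare (λ sq′ → ¬sq (square-cancel z≢0 sq (subst IsSquare (*-comm g z) sq′)))))
        (subst (_≤ 2) (sym (ℕ.+-identityʳ _)) (fibre-square-≤2 z))
      by-cases (no z≢0) (no ¬sq′) = subst (λ f → f ℕ.+ fibre (_^ 2) (g * z) ≤ 2) (sym (fibre-nonsquare ¬sq′)) (fibre-square-≤2 (g * z))

  -- If x y were a nonsquare too, neither y nor x y would have square roots, whereas `fibre-twist`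
  -- with g = x demands two in total.
  nonsquare-* : ∀ {x y} → ¬ IsSquare x → ¬ IsSquare y → IsSquare (x * y)
  nonsquare-* {x} {y} ¬sqx ¬sqy with isSquare? (x * y)
  ... | yes sq = sq
  ... | no ¬sq = contradiction
    (trans (sym (cong₂ ℕ._+_ (fibre-nonsquare ¬sqy) (fibre-nonsquare ¬sq))) (fibre-twist ¬sqx y)) (λ ())

  ν : Fin q → ℕ
  ν z = ⟦ ¬? (isSquare? z) ⟧

  Even Odd : ℕ → Set
  Even c = ∃[ k ] c ≡ 2 ℕ.* k
  Odd  c = ∃[ k ] c ≡ suc (2 ℕ.* k)

  -- Multiplicativity of the quadratic character: every nonsquare factor switches the class of the
  -- product and raises the sum of `ν` by 1.
  product-parity : ∀ zs → All (_≢ 0#) zs →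
    (IsSquare (product zs) × Even (ListAction.sum (List.map ν zs))) ⊎ (¬ IsSquare (product zs) × Odd (ListAction.sum (List.map ν zs)))
  product-parity [] [] = inj₁ (1-square , 0 , refl)
  product-parity (z ∷ zs) (z≢0 ∷ zs≢0) with isSquare? z | product-parity zs zs≢0
  ... | yes sqz | inj₁ (sq , even)         = inj₁ (square-* sqz sq , even)
  ... | yes sqz | inj₂ (¬sq , odd)         = inj₂ (¬sq ∘ square-cancel z≢0 sqz , odd)
  ... | no ¬sqz | inj₁ (sq , k , e)        = inj₂ ((λ sq′ → ¬sqz (nonsquare-cancel sq sq′)) , k , cong suc e)
    where
    product≢0 : ∀ {zs} → All (_≢ 0#) zs → product zs ≢ 0#
    product≢0 []        = 1≢0
    product≢0 (p ∷ ps) = *-≢0 p (product≢0 ps)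
    nonsquare-cancel : IsSquare (product zs) → IsSquare (z * product zs) → IsSquare z
    nonsquare-cancel sq sq′ = square-cancel (product≢0 zs≢0) sq (subst IsSquare (*-comm z (product zs)) sq′)
  ... | no ¬sqz | inj₂ (¬sq , k , e)       = inj₁ (nonsquare-* ¬sqz ¬sq , suc k ,
    trans (cong suc e) (cong suc (sym (ℕ.+-suc k (k ℕ.+ 0)))))

  neg-injective : ∀ {x y} → - x ≡ - y → x ≡ y
  neg-injective {x} {y} e = trans (solve 1 (λ x → x := :- (:- x)) refl x) (trans (cong -_ e) (solve 1 (λ y → :- (:- y) := y) refl y))

  -- The polynomial T + 1 is the product of the X - r over the elements r of trace -1.
  -- At X = 0 it takes the square value 1.
  even-nonsquares : Even (∑ (λ z → ⟦ T z ≟ 1# ⟧ ℕ.* ν z))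
  even-nonsquares = subst Even (begin
      ListAction.sum (List.map ν zs)                           ≡⟨ cong ListAction.sum (sym (map-∘ rs)) ⟩
      ListAction.sum (List.map (λ r → ν (0# - r)) rs)          ≡⟨ sum-map-filter-tabulate (λ r → T r ≟ - 1#) (λ r → ν (0# - r)) id ⟩
      ∑ (λ r → ⟦ T r ≟ - 1# ⟧ ℕ.* ν (0# - r))                  ≡⟨ ∑-cong (λ r → cong₂ ℕ._*_ (flip-trace r) (cong ν (+-identityˡ (- r)))) ⟩
      ∑ (λ r → ⟦ T (- r) ≟ 1# ⟧ ℕ.* ν (- r))                   ≡⟨ ∑-injective -_ neg-injective (λ z → ⟦ T z ≟ 1# ⟧ ℕ.* ν z) ⟩
      ∑ (λ z → ⟦ T z ≟ 1# ⟧ ℕ.* ν z)                           ∎)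
    (even (product-parity zs zs≢0))
    where
    open ≡-Reasoning
    rs zs : List (Fin q)
    rs = roots T (- 1#)
    zs = List.map (λ r → 0# - r) rs

    flip-trace : ∀ r → ⟦ T r ≟ - 1# ⟧ ≡ ⟦ T (- r) ≟ 1# ⟧
    flip-trace r = ⟦⟧-cong (T r ≟ - 1#) (T (- r) ≟ 1#)
      (λ e → trans (T-neg r) (trans (cong -_ e) (solve 0 (:- (:- con 𝟙) := con 𝟙) refl)))
      (λ e → neg-injective (trans (sym (T-neg r)) (trans e (solve 0 (con 𝟙 := :- (:- con 𝟙)) refl))))

    -- The 3 ^ m roots exhaust the degree, so the cofactor is constant, equal to the leading
    -- coefficient 1.
    g≡1 : ∀ {j g} → 3 ℕ.^ m ≡ fibre T (- 1#) ℕ.+ j → Poly 1# j g → ∀ x → g x ≡ 1#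
    g≡1         _ (constant g≡)  = g≡
    g≡1 {suc j} e (horner _ _ _) = contradiction
      (trans e (trans (cong (ℕ._+ suc j) (fibre-T -𝟙)) (ℕ.+-suc (3 ℕ.^ m) j))) (ℕ.m≢1+m+n (3 ℕ.^ m))

    product-zs : product zs ≡ 1#
    product-zs = let j , 3^m≡ , g , g-Poly , T+1≡ = Poly-factor-roots 1≢0 (Trace-Poly m) (- 1#) (ℕ.m^n>0 3 m) in begin
      product zs            ≡⟨ *-identityʳ _ ⟨
      product zs * 1#       ≡⟨ cong (product zs *_) (g≡1 3^m≡ g-Poly 0#) ⟨
      product zs * g 0#     ≡⟨ T+1≡ 0# ⟨
      T 0# - - 1#           ≡⟨ cong (_- - 1#) T-0 ⟩
      0# - - 1#             ≡⟨ solve 0 (con 𝟘 :- (:- con 𝟙) := con 𝟙) refl ⟩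
      1#                    ∎

    zs≢0 : All (_≢ 0#) zs
    zs≢0 = All.map⁺ (All.map (λ {r} Tr≡-1 0-r≡0 → -1≢0 (trans (sym Tr≡-1) (trans (cong T (sym (x-y≡0⇒x≡y 0-r≡0))) T-0)))
      (All.all-filter (λ r → T r ≟ - 1#) (allFin q)))

    even : (IsSquare (product zs) × Even (ListAction.sum (List.map ν zs))) ⊎ (¬ IsSquare (product zs) × Odd (ListAction.sum (List.map ν zs))) →
           Even (ListAction.sum (List.map ν zs))
    even (inj₁ (_ , e)) = e
    even (inj₂ (¬sq , _)) = contradiction (subst IsSquare (sym product-zs) 1-square) ¬sq

-- The forms Tr (g y²) and their value distribution.

module TraceForms {m : ℕ} (K : FiniteField (3 ℕ.^ suc m)) where

  open ≡ using (refl; sym; trans)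
  open TernaryField {m} K
  open Squares {m} K

  private
    q : ℕ
    q = 3 ℕ.^ suc m

  -- At g = 1 these are N₀, N₁ and N₂; other g arise as the coefficient δ³ left by the change of
  -- variables on the curve.
  N : Fin q → 𝔽₃ → ℕ
  N g j = ∑ (λ y → ⟦ T (g * y ^ 2) ≟ embed j ⟧)

  N-square : ∀ {g} → g ≢ 0# → IsSquare g → ∀ j → N g j ≡ N 1# j
  N-square g≢0 (h , refl) j = trans
    (∑-cong (λ y → cong (λ z → ⟦ T z ≟ embed j ⟧) (solve 2 (λ h y → h :^ 2 :* y :^ 2 := con 𝟙 :* (h :* y) :^ 2) refl h y)))
    (∑-injective (h *_) (*-cancelˡ-≢0 (λ { refl → g≢0 (zeroˡ _) })) (λ y → ⟦ T (1# * y ^ 2) ≟ embed j ⟧))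

  fibre-T-* : ∀ {g} → g ≢ 0# → ∀ j → ∑ (λ z → ⟦ T (g * z) ≟ embed j ⟧) ≡ 3 ℕ.^ m
  fibre-T-* {g} g≢0 j = trans (∑-injective (g *_) (*-cancelˡ-≢0 g≢0) (λ z → ⟦ T z ≟ embed j ⟧)) (fibre-T j)

  -- Both counts become sums over the same z with `T (g * z)` equal to j, weighted in one case by
  -- the square roots of z and in the other by those of g z. By `fibre-twist` the weights add up to
  -- 2 at every z.
  N-twist : ∀ {g} → ¬ IsSquare g → ∀ j → N g j ℕ.+ N 1# j ≡ 2 ℕ.* 3 ℕ.^ m
  N-twist {g} ¬sq j = begin
    N g j ℕ.+ N 1# j                              ≡⟨ cong₂ ℕ._+_ (∑-∘ (_^ 2) (λ z → ⟦ T (g * z) ≟ embed j ⟧)) N1≡ ⟩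
    ∑ (λ z → r z ℕ.* I z) ℕ.+ ∑ (λ z → r (g * z) ℕ.* I z)  ≡⟨ ∑-+ (λ z → r z ℕ.* I z) (λ z → r (g * z) ℕ.* I z) ⟨
    ∑ (λ z → r z ℕ.* I z ℕ.+ r (g * z) ℕ.* I z)   ≡⟨ ∑-cong (λ z → sym (ℕ.*-distribʳ-+ (I z) (r z) (r (g * z)))) ⟩
    ∑ (λ z → (r z ℕ.+ r (g * z)) ℕ.* I z)         ≡⟨ ∑-cong (λ z → cong (ℕ._* I z) (fibre-twist ¬sq z)) ⟩
    ∑ (λ z → 2 ℕ.* I z)                           ≡⟨ ∑-*ˡ 2 I ⟨
    2 ℕ.* ∑ I                                     ≡⟨ cong (2 ℕ.*_) (fibre-T-* (nonsquare⇒≢0 ¬sq) j) ⟩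
    2 ℕ.* 3 ℕ.^ m                                 ∎
    where
    open ≡-Reasoning
    r I : Fin q → ℕ
    r = fibre (_^ 2)
    I z = ⟦ T (g * z) ≟ embed j ⟧
    N1≡ : N 1# j ≡ ∑ (λ z → r (g * z) ℕ.* I z)
    N1≡ = begin
      N 1# j                                            ≡⟨ ∑-cong (λ y → cong (λ z → ⟦ T z ≟ embed j ⟧) (*-identityˡ (y ^ 2))) ⟩
      ∑ (λ y → ⟦ T (y ^ 2) ≟ embed j ⟧)                 ≡⟨ ∑-∘ (_^ 2) (λ z → ⟦ T z ≟ embed j ⟧) ⟩
      ∑ (λ z → r z ℕ.* ⟦ T z ≟ embed j ⟧)               ≡⟨ ∑-injective (g *_) (*-cancelˡ-≢0 (nonsquare⇒≢0 ¬sq)) (λ z → r z ℕ.* ⟦ T z ≟ embed j ⟧) ⟨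
      ∑ (λ z → r (g * z) ℕ.* I z)                       ∎

  N-neg : ∀ j → N (- 1#) j ≡ N 1# (-₃ j)
  N-neg j = ∑-cong (λ y → ⟦⟧-cong (T (- 1# * y ^ 2) ≟ embed j) (T (1# * y ^ 2) ≟ embed (-₃ j))
    (λ e → neg-injective (trans (sym (neg y)) (trans e (trans (solve 1 (λ x → x := :- (:- x)) refl (embed j)) (cong -_ (sym (embed-neg j)))))))
    (λ e → trans (neg y) (trans (cong -_ (trans e (embed-neg j))) (solve 1 (λ x → :- (:- x) := x) refl (embed j)))))
    where
    neg : ∀ y → T (- 1# * y ^ 2) ≡ - T (1# * y ^ 2)
    neg y = trans (cong T (solve 1 (λ y → (:- con 𝟙) :* y :^ 2 := :- (con 𝟙 :* y :^ 2)) refl y)) (T-neg (1# * y ^ 2))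

  ∑₃-N : ∑₃ (N 1#) ≡ q
  ∑₃-N = begin
    ∑₃ (N 1#)                                              ≡⟨ ∑₃-∑ (λ j y → ⟦ T (1# * y ^ 2) ≟ embed j ⟧) ⟩
    ∑ (λ y → ∑₃ (λ j → ⟦ T (1# * y ^ 2) ≟ embed j ⟧))      ≡⟨ ∑-cong (λ y → ∑₃-⟦T⟧ (1# * y ^ 2)) ⟩
    ∑ {q} (λ _ → 1)                                        ≡⟨ trans (∑-const q 1) (ℕ.*-identityʳ q) ⟩
    q                                                      ∎
    where open ≡-Reasoning

  -- Each row x ≠ 0 contributes 3 ^ m; the row x = 0 contributes all of q = 3 ^ m + 2 · 3 ^ m.
  count-hyperbolic : ∑ (λ x → ∑ (λ y → ⟦ T (x * y) ≟ 0# ⟧)) ≡ q ℕ.* 3 ℕ.^ m ℕ.+ 2 ℕ.* 3 ℕ.^ m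
  count-hyperbolic = begin
    ∑ (λ x → ∑ (λ y → ⟦ T (x * y) ≟ 0# ⟧))                        ≡⟨ ∑-cong row ⟩
    ∑ (λ x → 3 ℕ.^ m ℕ.+ ⟦ 0# ≟ x ⟧ ℕ.* (2 ℕ.* 3 ℕ.^ m))          ≡⟨ ∑-+ (λ _ → 3 ℕ.^ m) (λ x → ⟦ 0# ≟ x ⟧ ℕ.* (2 ℕ.* 3 ℕ.^ m)) ⟩
    ∑ {q} (λ _ → 3 ℕ.^ m) ℕ.+ ∑ (λ x → ⟦ 0# ≟ x ⟧ ℕ.* (2 ℕ.* 3 ℕ.^ m))  ≡⟨ cong₂ ℕ._+_ (∑-const q (3 ℕ.^ m)) (∑-δ 0# (λ _ → 2 ℕ.* 3 ℕ.^ m)) ⟩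
    q ℕ.* 3 ℕ.^ m ℕ.+ 2 ℕ.* 3 ℕ.^ m                               ∎
    where
    open ≡-Reasoning
    row : ∀ x → ∑ (λ y → ⟦ T (x * y) ≟ 0# ⟧) ≡ 3 ℕ.^ m ℕ.+ ⟦ 0# ≟ x ⟧ ℕ.* (2 ℕ.* 3 ℕ.^ m)
    row x with 0# ≟ x
    ... | yes refl = begin
      ∑ (λ y → ⟦ T (0# * y) ≟ 0# ⟧)   ≡⟨ ∑-cong (λ y → ⟦⟧-yes (T (0# * y) ≟ 0#) (trans (cong T (zeroˡ y)) T-0)) ⟩
      ∑ {q} (λ _ → 1)                 ≡⟨ trans (∑-const q 1) (ℕ.*-identityʳ q) ⟩
      q                               ≡⟨ cong (3 ℕ.^ m ℕ.+_) (ℕ.+-identityʳ _) ⟨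
      3 ℕ.^ m ℕ.+ 1 ℕ.* (2 ℕ.* 3 ℕ.^ m) ∎
    ... | no 0≢x = trans (fibre-T-* (0≢x ∘ sym) 𝟘) (sym (ℕ.+-identityʳ _))

  -- Both sides count the pairs with Tr (y² - x²) = 0; the shift y ↦ y + x makes the form y (y - x), as 2 = -1.
  ∑₃-N² : ∑₃ (λ j → N 1# j ℕ.* N 1# j) ≡ q ℕ.* 3 ℕ.^ m ℕ.+ 2 ℕ.* 3 ℕ.^ m
  ∑₃-N² = begin
    ∑₃ (λ j → N 1# j ℕ.* N 1# j)
      ≡⟨ ∑₃-cong {λ j → N 1# j ℕ.* N 1# j} (λ j → ∑-*ʳ (N 1# j) (λ x → ⟦ T (1# * x ^ 2) ≟ embed j ⟧)) ⟩
    ∑₃ (λ j → ∑ (λ x → ⟦ T (1# * x ^ 2) ≟ embed j ⟧ ℕ.* N 1# j))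
      ≡⟨ ∑₃-∑ (λ j x → ⟦ T (1# * x ^ 2) ≟ embed j ⟧ ℕ.* N 1# j) ⟩
    ∑ (λ x → ∑₃ (λ j → ⟦ T (1# * x ^ 2) ≟ embed j ⟧ ℕ.* N 1# j))
      ≡⟨ ∑-cong pairs ⟩
    ∑ (λ x → ∑ (λ y → ⟦ T (y * (y - x)) ≟ 0# ⟧))
      ≡⟨ ∑-swap (λ x y → ⟦ T (y * (y - x)) ≟ 0# ⟧) ⟩
    ∑ (λ y → ∑ (λ x → ⟦ T (y * (y - x)) ≟ 0# ⟧))
      ≡⟨ ∑-cong (λ y → ∑-injective (λ x → y - x) (λ {x} {x′} → sub-injective y x x′) (λ x → ⟦ T (y * x) ≟ 0# ⟧)) ⟩
    ∑ (λ y → ∑ (λ x → ⟦ T (y * x) ≟ 0# ⟧))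
      ≡⟨ count-hyperbolic ⟩
    q ℕ.* 3 ℕ.^ m ℕ.+ 2 ℕ.* 3 ℕ.^ m ∎
    where
    open ≡-Reasoning
    sub-injective : ∀ y x x′ → y - x ≡ y - x′ → x ≡ x′
    sub-injective y x x′ e = trans (solve 2 (λ x y → x := y :- (y :- x)) refl x y)
      (trans (cong (λ z → y - z) e) (solve 2 (λ x y → y :- (y :- x) := x) refl x′ y))
    +-injective : ∀ x y y′ → y + x ≡ y′ + x → y ≡ y′
    +-injective x y y′ e = trans (solve 2 (λ x y → y := y :+ x :- x) refl x y)
      (trans (cong (_- x) e) (solve 2 (λ x y → y :+ x :- x := y) refl x y′))
    pairs : ∀ x → ∑₃ (λ j → ⟦ T (1# * x ^ 2) ≟ embed j ⟧ ℕ.* N 1# j) ≡ ∑ (λ y → ⟦ T (y * (y - x)) ≟ 0# ⟧)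
    pairs x = let j , Tx²≡j = trace (1# * x ^ 2) in begin
      ∑₃ (λ i → ⟦ T (1# * x ^ 2) ≟ embed i ⟧ ℕ.* N 1# i)       ≡⟨ ∑₃-δ (1# * x ^ 2) (N 1#) {j} Tx²≡j ⟩
      N 1# j                                                   ≡⟨ ∑-injective (_+ x) (λ {y} {y′} → +-injective x y y′) (λ y → ⟦ T (1# * y ^ 2) ≟ embed j ⟧) ⟨
      ∑ (λ y → ⟦ T (1# * (y + x) ^ 2) ≟ embed j ⟧)             ≡⟨ ∑-cong (λ y → ⟦⟧-cong (T (1# * (y + x) ^ 2) ≟ embed j) (T (y * (y - x)) ≟ 0#)
        (λ e → trans (expand y) (trans (cong₂ _-_ e Tx²≡j) (-‿inverseʳ (embed j))))
        (λ e → trans (x-y≡0⇒x≡y (trans (sym (expand y)) e)) Tx²≡j)) ⟩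
      ∑ (λ y → ⟦ T (y * (y - x)) ≟ 0# ⟧)                       ∎
      where
      expand : ∀ y → T (y * (y - x)) ≡ T (1# * (y + x) ^ 2) - T (1# * x ^ 2)
      expand y = trans (cong T (solve 2 (λ x y → y :* (y :- x) := con 𝟙 :* (y :+ x) :^ 2 :- con 𝟙 :* x :^ 2) refl x y)) (T-sub _ _)

  -- Each nonzero square has two roots, so N 1# 𝟙 falls short of twice the number of z of trace 1 by 2 for each nonsquare.
  N-parity : ∃[ k ] N 1# 𝟙 ℕ.+ 4 ℕ.* k ≡ 2 ℕ.* 3 ℕ.^ m
  N-parity = let k , ∑ν≡2k = even-nonsquares in k , (begin
    N 1# 𝟙 ℕ.+ 4 ℕ.* k                                                ≡⟨ cong (N 1# 𝟙 ℕ.+_) (trans (ℕ.*-assoc 2 2 k) (cong (2 ℕ.*_) (sym ∑ν≡2k))) ⟩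
    N 1# 𝟙 ℕ.+ 2 ℕ.* ∑ (λ z → I z ℕ.* ν z)                            ≡⟨ cong₂ ℕ._+_ N≡ (∑-*ˡ 2 (λ z → I z ℕ.* ν z)) ⟩
    ∑ (λ z → r z ℕ.* I z) ℕ.+ ∑ (λ z → 2 ℕ.* (I z ℕ.* ν z))           ≡⟨ ∑-+ (λ z → r z ℕ.* I z) (λ z → 2 ℕ.* (I z ℕ.* ν z)) ⟨
    ∑ (λ z → r z ℕ.* I z ℕ.+ 2 ℕ.* (I z ℕ.* ν z))                     ≡⟨ ∑-cong pointwise ⟩
    ∑ (λ z → 2 ℕ.* I z)                                               ≡⟨ ∑-*ˡ 2 I ⟨
    2 ℕ.* fibre T 1#                                                  ≡⟨ cong (2 ℕ.*_) (fibre-T 𝟙) ⟩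
    2 ℕ.* 3 ℕ.^ m                                                     ∎)
    where
    open ≡-Reasoning
    r I : Fin q → ℕ
    r = fibre (_^ 2)
    I z = ⟦ T z ≟ 1# ⟧
    N≡ : N 1# 𝟙 ≡ ∑ (λ z → r z ℕ.* I z)
    N≡ = trans (∑-cong (λ y → cong (λ z → ⟦ T z ≟ 1# ⟧) (*-identityˡ (y ^ 2)))) (∑-∘ (_^ 2) I)
    pointwise : ∀ z → r z ℕ.* I z ℕ.+ 2 ℕ.* (I z ℕ.* ν z) ≡ 2 ℕ.* I z
    pointwise z with T z ≟ 1#
    ... | no _ = trans (ℕ.+-identityʳ (r z ℕ.* 0)) (ℕ.*-zeroʳ (r z))
    ... | yes Tz≡1 with isSquare? z
    ...   | yes sq = trans (ℕ.+-identityʳ (r z ℕ.* 1)) (trans (ℕ.*-identityʳ (r z))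
                       (fibre-square (λ { refl → 0≢1 (trans (sym T-0) Tz≡1) }) sq))
    ...   | no ¬sq = cong (λ c → c ℕ.* 1 ℕ.+ 2) (fibre-nonsquare ¬sq)

  affineCount : Fin q → Fin q → ℕ
  affineCount a b = ∑ (λ x → ∑ (λ y → ⟦ y ^ 2 ≟ x ^ 3 + a * x + b ⟧))

  -- In characteristic 3 the map x³ + a x is additive, and a nonzero u in its kernel would satisfy
  -- u² = -a. So the cubic takes every value once, and the square roots of all field elements number
  -- q.
  affineCount-nonsquare : ∀ {a} b → ¬ IsSquare (- a) → affineCount a b ≡ q
  affineCount-nonsquare {a} b ¬sq = trans (∑-injective (λ x → x ^ 3 + a * x + b) injective (fibre (_^ 2))) (∑-fibre (_^ 2))
    where
    injective : ∀ {x y} → x ^ 3 + a * x + b ≡ y ^ 3 + a * y + b → x ≡ y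
    injective {x} {y} e = [ x-y≡0⇒x≡y , (λ e′ → contradiction (x - y , x-y≡0⇒x≡y e′) ¬sq) ]′ (*≡0⇒≡0 difference)
      where
      difference : (x - y) * ((x - y) ^ 2 - - a) ≡ 0#
      difference = trans
        (solve 4 (λ x y a b → (x :- y) :* ((x :- y) :^ 2 :- (:- a)) := x :^ 3 :+ a :* x :+ b :- (y :^ 3 :+ a :* y :+ b)) refl x y a b)
        (trans (cong (_- (y ^ 3 + a * y + b)) e) (-‿inverseʳ _))

  -- Substituting γ x for x turns y² = x³ - γ² x + b into δ³ y² - δ³ b = x³ - x.
  affineCount-square : ∀ {a γ δ} b j → γ ≢ 0# → - a ≡ γ ^ 2 → δ * γ ≡ 1# → T (b * δ ^ 3) ≡ embed j →
    affineCount a b ≡ 3 ℕ.* N (δ ^ 3) j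
  affineCount-square {a} {γ} {δ} b j γ≢0 -a≡γ² δγ≡1 Tbδ³≡j = begin
    ∑ (λ x → fibre (_^ 2) (x ^ 3 + a * x + b))                          ≡⟨ ∑-injective (γ *_) (*-cancelˡ-≢0 γ≢0) (λ x → fibre (_^ 2) (x ^ 3 + a * x + b)) ⟨
    ∑ (λ x → ∑ (λ y → ⟦ y ^ 2 ≟ (γ * x) ^ 3 + a * (γ * x) + b ⟧))       ≡⟨ ∑-cong (λ x → ∑-cong (λ y → substitute x y)) ⟩
    ∑ (λ x → ∑ (λ y → ⟦ ℘ x ≟ δ ^ 3 * y ^ 2 - b * δ ^ 3 ⟧))             ≡⟨ ∑-swap (λ x y → ⟦ ℘ x ≟ δ ^ 3 * y ^ 2 - b * δ ^ 3 ⟧) ⟩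
    ∑ (λ y → fibre ℘ (δ ^ 3 * y ^ 2 - b * δ ^ 3))                       ≡⟨ ∑-cong (λ y → fibre-℘ (δ ^ 3 * y ^ 2 - b * δ ^ 3)) ⟩
    ∑ (λ y → 3 ℕ.* ⟦ T (δ ^ 3 * y ^ 2 - b * δ ^ 3) ≟ 0# ⟧)              ≡⟨ ∑-*ˡ 3 (λ y → ⟦ T (δ ^ 3 * y ^ 2 - b * δ ^ 3) ≟ 0# ⟧) ⟨
    3 ℕ.* ∑ (λ y → ⟦ T (δ ^ 3 * y ^ 2 - b * δ ^ 3) ≟ 0# ⟧)              ≡⟨ cong (3 ℕ.*_) (∑-cong traces) ⟩
    3 ℕ.* N (δ ^ 3) j                                                   ∎
    where
    open ≡-Reasoning

    identity₁ : ∀ x → γ ^ 3 * ℘ x + b ≡ (γ * x) ^ 3 + a * (γ * x) + b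
    identity₁ x = trans (solve 3 (λ γ x b → γ :^ 3 :* (x :^ 3 :- x) :+ b := (γ :* x) :^ 3 :- γ :^ 2 :* (γ :* x) :+ b) refl γ x b)
      (trans (cong (λ c → (γ * x) ^ 3 - c * (γ * x) + b) (sym -a≡γ²))
        (solve 4 (λ γ x a b → (γ :* x) :^ 3 :- (:- a) :* (γ :* x) :+ b := (γ :* x) :^ 3 :+ a :* (γ :* x) :+ b) refl γ x a b))

    δ³γ³* : ∀ z → δ ^ 3 * (γ ^ 3 * z) ≡ z
    δ³γ³* z = trans (solve 3 (λ δ γ z → δ :^ 3 :* (γ :^ 3 :* z) := (δ :* γ) :^ 3 :* z) refl δ γ z)
      (trans (cong (λ u → u ^ 3 * z) δγ≡1) (solve 1 (λ z → con 𝟙 :^ 3 :* z := z) refl z))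

    substitute : ∀ x y → ⟦ y ^ 2 ≟ (γ * x) ^ 3 + a * (γ * x) + b ⟧ ≡ ⟦ ℘ x ≟ δ ^ 3 * y ^ 2 - b * δ ^ 3 ⟧
    substitute x y = ⟦⟧-cong (y ^ 2 ≟ (γ * x) ^ 3 + a * (γ * x) + b) (℘ x ≟ δ ^ 3 * y ^ 2 - b * δ ^ 3)
      (λ e → begin
        ℘ x                                             ≡⟨ δ³γ³* (℘ x) ⟨
        δ ^ 3 * (γ ^ 3 * ℘ x)                           ≡⟨ solve 3 (λ d c b → d :* c := d :* (c :+ b) :- b :* d) refl (δ ^ 3) (γ ^ 3 * ℘ x) b ⟩
        δ ^ 3 * (γ ^ 3 * ℘ x + b) - b * δ ^ 3           ≡⟨ cong (λ z → δ ^ 3 * z - b * δ ^ 3) (trans (identity₁ x) (sym e)) ⟩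
        δ ^ 3 * y ^ 2 - b * δ ^ 3                       ∎)
      (λ e → begin
        y ^ 2                                           ≡⟨ δ³γ³* (y ^ 2) ⟨
        δ ^ 3 * (γ ^ 3 * y ^ 2)                         ≡⟨ solve 4 (λ d c b y → d :* (c :* y) := c :* (d :* y :- b :* d) :+ d :* (c :* b)) refl (δ ^ 3) (γ ^ 3) b (y ^ 2) ⟩
        γ ^ 3 * (δ ^ 3 * y ^ 2 - b * δ ^ 3) + δ ^ 3 * (γ ^ 3 * b)  ≡⟨ cong₂ (λ z w → γ ^ 3 * z + w) (sym e) (δ³γ³* b) ⟩
        γ ^ 3 * ℘ x + b                                 ≡⟨ identity₁ x ⟩
        (γ * x) ^ 3 + a * (γ * x) + b                   ∎)

    traces : ∀ y → ⟦ T (δ ^ 3 * y ^ 2 - b * δ ^ 3) ≟ 0# ⟧ ≡ ⟦ T (δ ^ 3 * y ^ 2) ≟ embed j ⟧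
    traces y = ⟦⟧-cong (T (δ ^ 3 * y ^ 2 - b * δ ^ 3) ≟ 0#) (T (δ ^ 3 * y ^ 2) ≟ embed j)
      (λ e → trans (x-y≡0⇒x≡y (trans (sym (T-sub _ _)) e)) Tbδ³≡j)
      (λ e → trans (T-sub _ _) (trans (cong₂ _-_ e Tbδ³≡j) (-‿inverseʳ (embed j))))

open import Data.Integer using (ℤ; +_; -[1+_]; ∣_∣)

-- Integer arithmetic: the signed square root of a power of 3.

module SignedRoots where

  open ≡ using (refl; sym; trans)
  open import Data.Integer using (_+_; _-_; _*_)

  -3ℤ : ℤ
  -3ℤ = -[1+ 2 ]

  prime-3 : Prime 3
  prime-3 = toWitness {a? = prime? 3} _

  -- The factor split off is -3 and not 3, since -3 ≡ 1 (mod 4) lets the congruence of `signed-root`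
  -- pass to the quotient.
  3∣s²⇒3∣s : ∀ s k → s * s ≡ + (3 ℕ.* k) → ∃[ u ] s ≡ -3ℤ * u
  3∣s²⇒3∣s s k s²≡3k
    with divides u s≡u*3 ← ∣ᵤ⇒∣ {+ 3} {s} ([ id , id ]′ (euclidsLemma ∣ s ∣ ∣ s ∣ prime-3
      (subst (3 ∣_) (trans (cong ∣_∣ (sym s²≡3k)) (ℤ.abs-* s s)) (m∣m*n k))))
    = ℤ.- u , trans s≡u*3 (identity u)
    where
    identity : ∀ u → u * + 3 ≡ -3ℤ * (ℤ.- u)
    identity = solve-∀

  -1≢1+4z : ∀ z → -[1+ 0 ] ≢ + 1 + + 4 * z
  -1≢1+4z z e = absurd (∣ z ∣) (trans (cong ∣_∣ (trans (cong (_- + 1) e) (identity z))) (ℤ.abs-* (+ 4) z))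
    where
    identity : ∀ z → + 1 + + 4 * z - + 1 ≡ + 4 * z
    identity = solve-∀
    absurd : ∀ n → 2 ≢ 4 ℕ.* n
    absurd (suc n) e with () ← trans e (ℕ.*-suc 4 n)

  square≢3 : ∀ k → k ℕ.* k ≢ 3
  square≢3 (suc (suc k)) k²≡3 =
    contradiction (subst (4 ≤_) k²≡3 (ℕ.*-mono-≤ {2} {suc (suc k)} {2} (s≤s (s≤s z≤n)) (s≤s (s≤s z≤n)))) (λ { (s≤s (s≤s (s≤s ()))) })

  ∣s∣≡1⇒s≡±1 : ∀ s → ∣ s ∣ ≡ 1 → s ≡ + 1 ⊎ s ≡ -[1+ 0 ]
  ∣s∣≡1⇒s≡±1 (+ 1)    refl = inj₁ refl
  ∣s∣≡1⇒s≡±1 -[1+ 0 ] refl = inj₂ refl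

  square-/9 : ∀ n u → -3ℤ * u * (-3ℤ * u) ≡ + (3 ℕ.^ suc (suc n)) → u * u ≡ + (3 ℕ.^ n)
  square-/9 n u 9u²≡ = ℤ.*-cancelˡ-≡ (+ 9) _ _ (begin
    + 9 * (u * u)              ≡⟨ identity u ⟩
    -3ℤ * u * (-3ℤ * u)        ≡⟨ 9u²≡ ⟩
    + (3 ℕ.^ suc (suc n))      ≡⟨ cong +_ (ℕ.*-assoc 3 3 (3 ℕ.^ n)) ⟨
    + (9 ℕ.* 3 ℕ.^ n)          ≡⟨ ℤ.pos-* 9 (3 ℕ.^ n) ⟩
    + 9 * + (3 ℕ.^ n)          ∎)
    where
    open ≡-Reasoning
    identity : ∀ u → + 9 * (u * u) ≡ -3ℤ * u * (-3ℤ * u)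
    identity = solve-∀

  -- Modulo 4 both -3 and 9 are 1 and may be dropped. The multiple of 4 results from writing u = 4 u
  -- - 3 u and 9 u² = u² + 8 u².
  congruence-/-3 : ∀ u z → -3ℤ * u ≡ -3ℤ * u * (-3ℤ * u) + + 4 * z → u ≡ u * u + + 4 * (u + + 2 * (u * u) + z)
  congruence-/-3 u z e = trans (before u) (trans (cong (λ t → + 4 * u + t) e) (after u z))
    where
    before : ∀ u → u ≡ + 4 * u + -3ℤ * u
    before = solve-∀
    after : ∀ u z → + 4 * u + (-3ℤ * u * (-3ℤ * u) + + 4 * z) ≡ u * u + + 4 * (u + + 2 * (u * u) + z)
    after = solve-∀

  -- The congruence s ≡ s² (mod 4) selects the sign of the square root s of 3ⁿ.
  signed-root : ∀ n s z → s * s ≡ + (3 ℕ.^ n) → s ≡ s * s + + 4 * z → ∃[ j ] n ≡ j ℕ.+ j × s ≡ -3ℤ ℤ.^ j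
  signed-root zero s z s²≡1 s≡ with ∣s∣≡1⇒s≡±1 s (ℕ.m*n≡1⇒m≡1 ∣ s ∣ ∣ s ∣ (trans (sym (ℤ.abs-* s s)) (cong ∣_∣ s²≡1)))
  ... | inj₁ refl = 0 , refl , refl
  ... | inj₂ refl = contradiction s≡ (-1≢1+4z z)
  -- Odd exponents descend to this case, and 3 is not the square of an integer. Here the evenness of
  -- the exponent arises.
  signed-root (suc zero) s z s²≡3 s≡ = contradiction (trans (sym (ℤ.abs-* s s)) (cong ∣_∣ s²≡3)) (square≢3 ∣ s ∣)
  signed-root (suc (suc n)) s z s²≡ s≡
    = let u , s≡-3u      = 3∣s²⇒3∣s s (3 ℕ.^ suc n) s²≡
          j , n≡2j , u≡ = signed-root n u (u + + 2 * (u * u) + z)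
            (square-/9 n u (subst (λ s → s * s ≡ + (3 ℕ.^ suc (suc n))) s≡-3u s²≡))
            (congruence-/-3 u z (subst (λ s → s ≡ s * s + + 4 * z) s≡-3u s≡))
      in suc j , trans (cong (λ n → suc (suc n)) n≡2j) (cong suc (sym (ℕ.+-suc j j))) ,
         trans s≡-3u (cong (λ u → -3ℤ * u) u≡)

  -3^even : ∀ i → -3ℤ ℤ.^ (2 ℕ.* i) ≡ + (3 ℕ.^ (2 ℕ.* i))
  -3^even i = begin
    -3ℤ ℤ.^ (2 ℕ.* i)      ≡⟨ ℤ.^-*-assoc -3ℤ 2 i ⟨
    (+ 9) ℤ.^ i            ≡⟨ pos-^ 9 i ⟨
    + (9 ℕ.^ i)            ≡⟨ cong +_ (ℕ.^-*-assoc 3 2 i) ⟩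
    + (3 ℕ.^ (2 ℕ.* i))    ∎
    where
    open ≡-Reasoning
    pos-^ : ∀ b k → + (b ℕ.^ k) ≡ (+ b) ℤ.^ k
    pos-^ b zero    = refl
    pos-^ b (suc k) = trans (ℤ.pos-* b (b ℕ.^ k)) (cong (+ b *_) (pos-^ b k))

  -3^odd : ∀ i → -3ℤ ℤ.^ suc (2 ℕ.* i) ≡ ℤ.- + (3 ℕ.^ suc (2 ℕ.* i))
  -3^odd i = begin
    -3ℤ * -3ℤ ℤ.^ (2 ℕ.* i)          ≡⟨ cong (-3ℤ *_) (-3^even i) ⟩
    -3ℤ * + (3 ℕ.^ (2 ℕ.* i))        ≡⟨ ℤ.neg-distribˡ-* (+ 3) (+ (3 ℕ.^ (2 ℕ.* i))) ⟨
    ℤ.- (+ 3 * + (3 ℕ.^ (2 ℕ.* i)))  ≡⟨ cong ℤ.-_ (ℤ.pos-* 3 (3 ℕ.^ (2 ℕ.* i))) ⟨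
    ℤ.- + (3 ℕ.^ suc (2 ℕ.* i))      ∎
    where open ≡-Reasoning

  linear-ℤ : ∀ a b k c M → a ℕ.+ b ℕ.* k ≡ c ℕ.* M → + a + + b * + k ≡ + c * + M
  linear-ℤ a b k c M e = trans (cong (λ t → + a + t) (sym (ℤ.pos-* b k))) (trans (cong +_ e) (ℤ.pos-* c M))

  squares-ℤ : ∀ a b c M → a ℕ.* a ℕ.+ b ℕ.* b ℕ.+ c ℕ.* c ≡ 3 ℕ.* M ℕ.* M ℕ.+ 2 ℕ.* M →
              + a * + a + + b * + b + + c * + c ≡ + 3 * + M * + M + + 2 * + M
  squares-ℤ a b c M e = begin
    + a * + a + + b * + b + + c * + c        ≡⟨ cong₂ _+_ (cong₂ _+_ (ℤ.pos-* a a) (ℤ.pos-* b b)) (ℤ.pos-* c c) ⟨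
    + (a ℕ.* a ℕ.+ b ℕ.* b ℕ.+ c ℕ.* c)      ≡⟨ cong +_ e ⟩
    + (3 ℕ.* M ℕ.* M) + + (2 ℕ.* M)          ≡⟨ cong₂ _+_ (trans (ℤ.pos-* (3 ℕ.* M) M) (cong (_* + M) (ℤ.pos-* 3 M))) (ℤ.pos-* 2 M) ⟩
    + 3 * + M * + M + + 2 * + M              ∎
    where open ≡-Reasoning

  -- N₀ + N₁ + N₂ = 3 M, N₀² + N₁² + N₂² = 3 M² + 2 M and N₁ + 4 k = 2 M, solved when N₁ + N₂ = 2 M ...
  odd-system : ∀ a b c k M → a ≡ M → c ≡ + 2 * M - b → a * a + b * b + c * c ≡ + 3 * M * M + + 2 * M →
    b + + 4 * k ≡ + 2 * M → let s = b - M in s * s ≡ M × s ≡ s * s + + 4 * (ℤ.- k)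
  odd-system _ b _ k M refl refl squares parity = s²≡M , (begin
    b - M                                 ≡⟨ identity₂ b k M ⟩
    b + + 4 * k - M + + 4 * (ℤ.- k)       ≡⟨ cong (λ t → t - M + + 4 * (ℤ.- k)) parity ⟩
    + 2 * M - M + + 4 * (ℤ.- k)           ≡⟨ identity₃ k M ⟩
    M + + 4 * (ℤ.- k)                     ≡⟨ cong (_+ + 4 * (ℤ.- k)) s²≡M ⟨
    (b - M) * (b - M) + + 4 * (ℤ.- k)     ∎)
    where
    open ≡-Reasoning
    identity₀ : ∀ b M → + 2 * ((b - M) * (b - M)) ≡ M * M + b * b + (+ 2 * M - b) * (+ 2 * M - b) - + 3 * M * M
    identity₀ = solve-∀
    identity₁ : ∀ M → + 3 * M * M + + 2 * M - + 3 * M * M ≡ + 2 * M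
    identity₁ = solve-∀
    identity₂ : ∀ b k M → b - M ≡ b + + 4 * k - M + + 4 * (ℤ.- k)
    identity₂ = solve-∀
    identity₃ : ∀ k M → + 2 * M - M + + 4 * (ℤ.- k) ≡ M + + 4 * (ℤ.- k)
    identity₃ = solve-∀
    s²≡M : (b - M) * (b - M) ≡ M
    s²≡M = ℤ.*-cancelˡ-≡ (+ 2) _ _ (trans (identity₀ b M) (trans (cong (_- + 3 * M * M) squares) (identity₁ M)))

  -- ... and when N₁ = N₂.
  even-system : ∀ a b c k M → a ≡ + 3 * M - + 2 * b → c ≡ b → a * a + b * b + c * c ≡ + 3 * M * M + + 2 * M →
    b + + 4 * k ≡ + 2 * M → let s = + 3 * (b - M) in s * s ≡ + 3 * M × s ≡ s * s + + 4 * (-3ℤ * k)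
  even-system _ b _ k M refl refl squares parity = s²≡3M , (begin
    + 3 * (b - M)                                     ≡⟨ identity₂ b k M ⟩
    + 3 * (b + + 4 * k - M) + + 4 * (-3ℤ * k)         ≡⟨ cong (λ t → + 3 * (t - M) + + 4 * (-3ℤ * k)) parity ⟩
    + 3 * (+ 2 * M - M) + + 4 * (-3ℤ * k)             ≡⟨ identity₃ k M ⟩
    + 3 * M + + 4 * (-3ℤ * k)                         ≡⟨ cong (_+ + 4 * (-3ℤ * k)) s²≡3M ⟨
    + 3 * (b - M) * (+ 3 * (b - M)) + + 4 * (-3ℤ * k) ∎)
    where
    open ≡-Reasoning
    identity₀ : ∀ b M → + 2 * (+ 3 * (b - M) * (+ 3 * (b - M))) ≡
      + 3 * ((+ 3 * M - + 2 * b) * (+ 3 * M - + 2 * b) + b * b + b * b - + 3 * M * M)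
    identity₀ = solve-∀
    identity₁ : ∀ M → + 3 * (+ 3 * M * M + + 2 * M - + 3 * M * M) ≡ + 2 * (+ 3 * M)
    identity₁ = solve-∀
    identity₂ : ∀ b k M → + 3 * (b - M) ≡ + 3 * (b + + 4 * k - M) + + 4 * (-3ℤ * k)
    identity₂ = solve-∀
    identity₃ : ∀ k M → + 3 * (+ 2 * M - M) + + 4 * (-3ℤ * k) ≡ + 3 * M + + 4 * (-3ℤ * k)
    identity₃ = solve-∀
    s²≡3M : + 3 * (b - M) * (+ 3 * (b - M)) ≡ + 3 * M
    s²≡3M = ℤ.*-cancelˡ-≡ (+ 2) _ _ (trans (identity₀ b M) (trans (cong (λ x → + 3 * (x - + 3 * M * M)) squares) (identity₁ M)))

  module _ (m : ℕ) {N₀ N₁ N₂ : ℕ}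
           (squares : N₀ ℕ.* N₀ ℕ.+ N₁ ℕ.* N₁ ℕ.+ N₂ ℕ.* N₂ ≡ 3 ℕ.^ suc m ℕ.* 3 ℕ.^ m ℕ.+ 2 ℕ.* 3 ℕ.^ m)
           (parity : ∃[ k ] N₁ ℕ.+ 4 ℕ.* k ≡ 2 ℕ.* 3 ℕ.^ m) where

    private
      M : ℕ
      M = 3 ℕ.^ m

    -- The number s = N₁ - M squares to M = 3 ^ m. Thus m is even, which later ties a nonsquare -1
    -- to odd degree m + 1.
    odd-solution : N₀ ℕ.+ N₀ ≡ 2 ℕ.* M → N₂ ℕ.+ N₁ ≡ 2 ℕ.* M → ∃[ j ] m ≡ j ℕ.+ j ×
      + N₀ ≡ + M × + N₁ ≡ + M + -3ℤ ℤ.^ j × + N₂ ≡ + M - -3ℤ ℤ.^ j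
    odd-solution 2N₀≡2M N₂+N₁≡2M =
      let k , N₁+4k≡2M = parity
          s²≡M , s≡s²-4k = odd-system (+ N₀) (+ N₁) (+ N₂) (+ k) (+ M) N₀≡M N₂≡2M-N₁ (squares-ℤ N₀ N₁ N₂ M squares) (linear-ℤ N₁ 4 k 2 M N₁+4k≡2M)
          j , m≡2j , s≡ = signed-root m (+ N₁ - + M) (ℤ.- + k) s²≡M s≡s²-4k
      in j , m≡2j , N₀≡M , trans (identity₁ (+ N₁) (+ M)) (cong (λ s → + M + s) s≡) ,
         trans N₂≡2M-N₁ (trans (identity₂ (+ N₁) (+ M)) (cong (λ s → + M - s) s≡))
      where
      N₀≡M : + N₀ ≡ + M
      N₀≡M = cong +_ (ℕ.*-cancelˡ-≡ N₀ M 2 (trans (cong (N₀ ℕ.+_) (ℕ.+-identityʳ _)) 2N₀≡2M))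

      identity₀ : ∀ c b → c ≡ c + b - b
      identity₀ = solve-∀
      identity₁ : ∀ b M → b ≡ M + (b - M)
      identity₁ = solve-∀
      identity₂ : ∀ b M → + 2 * M - b ≡ M - (b - M)
      identity₂ = solve-∀

      N₂≡2M-N₁ : + N₂ ≡ + 2 * + M - + N₁
      N₂≡2M-N₁ = trans (identity₀ (+ N₂) (+ N₁)) (cong (_- + N₁) (trans (cong +_ N₂+N₁≡2M) (ℤ.pos-* 2 M)))

    -- Now s = 3 (N₁ - M) squares to 3 M = 3 ^ (m + 1), so the degree is even. The conclusions are
    -- tripled because N₁ - M is only s / 3.
    even-solution : N₀ ℕ.+ N₁ ℕ.+ N₂ ≡ 3 ℕ.* M → N₁ ≡ N₂ → ∃[ e ] suc m ≡ e ℕ.+ e ×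
      + 3 * + N₀ ≡ + 3 * + M - + 2 * -3ℤ ℤ.^ e × + 3 * + N₁ ≡ + 3 * + M + -3ℤ ℤ.^ e
    even-solution total refl =
      let k , N₁+4k≡2M = parity
          s²≡3M , s≡s²-12k = even-system (+ N₀) (+ N₁) (+ N₁) (+ k) (+ M) N₀≡3M-2N₁ refl (squares-ℤ N₀ N₁ N₁ M squares) (linear-ℤ N₁ 4 k 2 M N₁+4k≡2M)
          e , m+1≡2e , s≡ = signed-root (suc m) (+ 3 * (+ N₁ - + M)) (-3ℤ * + k) (trans s²≡3M (sym (ℤ.pos-* 3 M))) s≡s²-12k
      in e , m+1≡2e ,
         trans (cong (λ n → + 3 * n) N₀≡3M-2N₁) (trans (identity₁ (+ N₁) (+ M)) (cong (λ s → + 3 * + M - + 2 * s) s≡)) ,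
         trans (identity₂ (+ N₁) (+ M)) (cong (λ s → + 3 * + M + s) s≡)
      where
      identity₀ : ∀ a b → a ≡ a + b + b - + 2 * b
      identity₀ = solve-∀
      identity₁ : ∀ b M → + 3 * (+ 3 * M - + 2 * b) ≡ + 3 * M - + 2 * (+ 3 * (b - M))
      identity₁ = solve-∀
      identity₂ : ∀ b M → + 3 * b ≡ + 3 * M + + 3 * (b - M)
      identity₂ = solve-∀

      N₀≡3M-2N₁ : + N₀ ≡ + 3 * + M - + 2 * + N₁
      N₀≡3M-2N₁ = trans (identity₀ (+ N₀) (+ N₁)) (cong (_- + 2 * + N₁) (trans (cong +_ total) (ℤ.pos-* 3 M)))

  even⊎odd : ∀ j → (∃[ i ] j ≡ 2 ℕ.* i) ⊎ (∃[ i ] j ≡ suc (2 ℕ.* i))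
  even⊎odd zero = inj₁ (0 , refl)
  even⊎odd (suc j) with even⊎odd j
  ... | inj₁ (i , j≡2i)   = inj₂ (i , cong suc j≡2i)
  ... | inj₂ (i , j≡2i+1) = inj₁ (suc i , trans (cong suc j≡2i+1) (cong suc (sym (ℕ.+-suc i (i ℕ.+ 0)))))

  -- The degree is d = r + 2 j with r = 1 or r = 0 according to its parity, so d mod 4 reveals the
  -- parity of j and with it the sign of (-3)ʲ.
  -3^-% : ∀ j r → r ≤ 1 → ((r ℕ.+ (j ℕ.+ j)) % 4 ≡ r → -3ℤ ℤ.^ j ≡ + (3 ℕ.^ j)) ×
                          ((r ℕ.+ (j ℕ.+ j)) % 4 ≡ 2 ℕ.+ r → -3ℤ ℤ.^ j ≡ ℤ.- + (3 ℕ.^ j))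
  -3^-% j r r≤1 with even⊎odd j
  ... | inj₁ (i , refl) = (λ _ → -3^even i) , λ e → contradiction (trans (sym e) (residue r r≤1)) (off r)
    where
    rearrange : ∀ r i → r ℕ.+ (2 ℕ.* i ℕ.+ 2 ℕ.* i) ≡ r ℕ.+ i ℕ.* 4
    rearrange = ℕ-Solver.solve-∀
    residue : ∀ r → r ≤ 1 → (r ℕ.+ (2 ℕ.* i ℕ.+ 2 ℕ.* i)) % 4 ≡ r
    residue 0 _ = trans (cong (_% 4) (rearrange 0 i)) ([m+kn]%n≡m%n 0 i 4)
    residue 1 _ = trans (cong (_% 4) (rearrange 1 i)) ([m+kn]%n≡m%n 1 i 4)
    residue (suc (suc _)) (s≤s ())
    off : ∀ r → 2 ℕ.+ r ≢ r
    off (suc r) e = off r (ℕ.suc-injective e)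
  ... | inj₂ (i , refl) = (λ e → contradiction (trans (sym (residue r r≤1)) e) (off r)) , λ _ → -3^odd i
    where
    rearrange : ∀ r i → r ℕ.+ (suc (2 ℕ.* i) ℕ.+ suc (2 ℕ.* i)) ≡ 2 ℕ.+ r ℕ.+ i ℕ.* 4
    rearrange = ℕ-Solver.solve-∀
    residue : ∀ r → r ≤ 1 → (r ℕ.+ (suc (2 ℕ.* i) ℕ.+ suc (2 ℕ.* i))) % 4 ≡ 2 ℕ.+ r
    residue 0 _ = trans (cong (_% 4) (rearrange 0 i)) ([m+kn]%n≡m%n 2 i 4)
    residue 1 _ = trans (cong (_% 4) (rearrange 1 i)) ([m+kn]%n≡m%n 3 i 4)
    residue (suc (suc _)) (s≤s ())
    off : ∀ r → 2 ℕ.+ r ≢ r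
    off (suc r) e = off r (ℕ.suc-injective e)

  2∤1+2j : ∀ j → ¬ (2 ∣ suc (j ℕ.+ j))
  2∤1+2j j (ℕ.divides k e) = odd≢even k j e
    where
    odd≢even : ∀ k j → suc (j ℕ.+ j) ≢ k ℕ.* 2
    odd≢even (suc k) zero    ()
    odd≢even (suc k) (suc j) e = odd≢even k j (ℕ.suc-injective (ℕ.suc-injective (trans (cong suc (cong suc (sym (ℕ.+-suc j j)))) e)))

  2∣2j : ∀ j → 2 ∣ j ℕ.+ j
  2∣2j j = ℕ.divides j (trans (cong (j ℕ.+_) (sym (ℕ.+-identityʳ j))) (ℕ.*-comm 2 j))

  scale-+ : ∀ k {s} x → s ≡ + x → + k * s ≡ + (k ℕ.* x)
  scale-+ k x s≡x = trans (cong (λ s → + k * s) s≡x) (sym (ℤ.pos-* k x))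

  scale-neg : ∀ k {s} x → s ≡ ℤ.- + x → + k * s ≡ ℤ.- + (k ℕ.* x)
  scale-neg k x s≡-x = trans (cong (λ s → + k * s) s≡-x)
    (trans (sym (ℤ.neg-distribʳ-* (+ k) (+ x))) (cong ℤ.-_ (sym (ℤ.pos-* k x))))

  neg-swap : ∀ s x → s ≡ ℤ.- + x → ℤ.- s ≡ + x
  neg-swap s x s≡-x = trans (cong ℤ.-_ s≡-x) (ℤ.neg-involutive (+ x))

open SignedRoots

-- From the value distribution to the number of points, over `Fin q`.

module TraceFormCounts {m : ℕ} (K : FiniteField (3 ℕ.^ suc m)) where

  open ≡ using (refl; sym; trans)
  open import Data.Integer using (_+_; _-_; _*_)
  open TernaryField {m} K hiding (_+_; _-_; _*_)
  open Squares {m} K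
  open TraceForms {m} K

  private
    M : ℕ
    M = 3 ℕ.^ m

  -- Multiplying the form by -1 both reflects the index j to -j and, as -1 is a nonsquare, reflects
  -- the count in M. Hence the counts at j and -j add up to 2 M, and j = 0 gives N₀ = M.
  odd-counts : ¬ IsSquare (- 1#) → ∃[ j ] m ≡ j ℕ.+ j ×
    + N 1# 𝟘 ≡ + M × + N 1# 𝟙 ≡ + M + -3ℤ ℤ.^ j × + N 1# -𝟙 ≡ + M - -3ℤ ℤ.^ j
  odd-counts ¬sq = odd-solution m ∑₃-N² N-parity (twist 𝟘) (twist 𝟙)
    where
    twist : ∀ j → N 1# (-₃ j) ℕ.+ N 1# j ≡ 2 ℕ.* M
    twist j = trans (cong (ℕ._+ N 1# j) (sym (N-neg j))) (N-twist ¬sq j)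

  N-±1 : IsSquare (- 1#) → N 1# 𝟙 ≡ N 1# -𝟙
  N-±1 sq = trans (sym (N-square -1≢0 sq 𝟙)) (N-neg 𝟙)

  even-counts : IsSquare (- 1#) → ∃[ e ] suc m ≡ e ℕ.+ e ×
    + 3 * + N 1# 𝟘 ≡ + 3 * + M - + 2 * -3ℤ ℤ.^ e × + 3 * + N 1# 𝟙 ≡ + 3 * + M + -3ℤ ℤ.^ e
  even-counts sq = even-solution m ∑₃-N² N-parity ∑₃-N (N-±1 sq)

module PointCounts {m : ℕ} (K : FiniteField (3 ℕ.^ suc m)) where

  open ≡ using (refl; sym; trans)
  open import Data.Integer using (_+_; _-_; _*_)
  private
    module K = TernaryField {m} K
    q : ℕ
    q = 3 ℕ.^ suc m
  open K using (1#; 0#; _^_; -_; T; embed)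
  open Squares {m} K
  open TraceForms {m} K
  open TraceFormCounts {m} K

  -- The deviation `t` of the point count from q + 1, the negative of the trace of Frobenius, can be
  -- read off from three times a value of `N`; all later counts are stated through it.
  point-count : ∀ n k t → n ≡ 3 ℕ.* k → + 3 * + k ≡ + q + t → + suc n ≡ + q + + 1 + t
  point-count n k t n≡3k 3k≡q+t = begin
    + 1 + + n            ≡⟨ cong (λ l → + 1 + + l) n≡3k ⟩
    + 1 + + (3 ℕ.* k)    ≡⟨ cong (λ l → + 1 + l) (trans (ℤ.pos-* 3 k) 3k≡q+t) ⟩
    + 1 + (+ q + t)      ≡⟨ identity (+ q) t ⟩
    + q + + 1 + t        ∎
    where
    open ≡-Reasoning
    identity : ∀ q t → + 1 + (q + t) ≡ q + + 1 + t
    identity = solve-∀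

  q≡3M : + q ≡ + 3 * + (3 ℕ.^ m)
  q≡3M = ℤ.pos-* 3 (3 ℕ.^ m)

  -- The quadratic twist on the level of counts: reflecting in q / 3 changes the sign of the
  -- deviation.
  3N-twist : ∀ {g} t → ¬ IsSquare g → ∀ i → + 3 * + N 1# i ≡ + q + t → + 3 * + N g i ≡ + q - t
  3N-twist {g} t ¬sq i 3N≡q+t = begin
    + 3 * + N g i                                             ≡⟨ identity₁ (+ N g i) (+ N 1# i) ⟩
    + 3 * (+ N g i + + N 1# i) - + 3 * + N 1# i               ≡⟨ cong₂ (λ x y → + 3 * x - y) (trans (cong +_ (N-twist ¬sq i)) (ℤ.pos-* 2 (3 ℕ.^ m))) 3N≡q+t ⟩
    + 3 * (+ 2 * + (3 ℕ.^ m)) - (+ q + t)                     ≡⟨ cong (λ x → + 3 * (+ 2 * + (3 ℕ.^ m)) - (x + t)) q≡3M ⟩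
    + 3 * (+ 2 * + (3 ℕ.^ m)) - (+ 3 * + (3 ℕ.^ m) + t)       ≡⟨ identity₂ (+ (3 ℕ.^ m)) t ⟩
    + 3 * + (3 ℕ.^ m) - t                                     ≡⟨ cong (_- t) q≡3M ⟨
    + q - t                                                   ∎
    where
    open ≡-Reasoning
    identity₁ : ∀ x y → + 3 * x ≡ + 3 * (x + y) - + 3 * y
    identity₁ = solve-∀
    identity₂ : ∀ M t → + 3 * (+ 2 * M) - (+ 3 * M + t) ≡ + 3 * M - t
    identity₂ = solve-∀

  -- The class of -1 is obtained backwards from the counts: a square -1 would make m + 1 even by
  -- `even-counts`, just as a nonsquare -1 makes m even by `odd-counts`.
  -1-nonsquare : ¬ (2 ∣ suc m) → ¬ IsSquare (- 1#)
  -1-nonsquare odd sq = let e , m+1≡2e , _ = even-counts sq in odd (subst (2 ∣_) (sym m+1≡2e) (2∣2j e))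

  -1-square : 2 ∣ suc m → IsSquare (- 1#)
  -1-square even = case (isSquare? (- 1#))
    where
    case : Dec (IsSquare (- 1#)) → IsSquare (- 1#)
    case (yes sq) = sq
    case (no ¬sq) = let j , m≡2j , _ = odd-counts ¬sq in contradiction (subst (λ m → 2 ∣ suc m) m≡2j even) (2∤1+2j j)

  module Odd (odd : ¬ (2 ∣ suc m)) where

    abstract
      root : ∃[ j ] m ≡ j ℕ.+ j × + 3 * + N 1# 𝟘 ≡ + q + + 0 ×
        + 3 * + N 1# 𝟙 ≡ + q + + 3 * -3ℤ ℤ.^ j × + 3 * + N 1# -𝟙 ≡ + q - + 3 * -3ℤ ℤ.^ j
      root =
        let j , m≡2j , N₀≡ , N₁≡ , N₂≡ = odd-counts (-1-nonsquare odd)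
            scale : ∀ {x y} → x ≡ y → + 3 * x ≡ + 3 * y
            scale = cong (λ x → + 3 * x)
        in j , m≡2j ,
           trans (scale N₀≡) (trans (sym q≡3M) (sym (ℤ.+-identityʳ (+ q)))) ,
           trans (scale N₁≡) (trans (plus (+ (3 ℕ.^ m)) (-3ℤ ℤ.^ j)) (cong (λ x → x + + 3 * -3ℤ ℤ.^ j) (sym q≡3M))) ,
           trans (scale N₂≡) (trans (minus (+ (3 ℕ.^ m)) (-3ℤ ℤ.^ j)) (cong (λ x → x - + 3 * -3ℤ ℤ.^ j) (sym q≡3M)))
        where
        plus : ∀ M s → + 3 * (M + s) ≡ + 3 * M + + 3 * s
        plus = solve-∀
        minus : ∀ M s → + 3 * (M - s) ≡ + 3 * M - + 3 * s
        minus = solve-∀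

  module Even (even : 2 ∣ suc m) where

    abstract
      root : ∃[ e ] suc m ≡ e ℕ.+ e × + 3 * + N 1# 𝟘 ≡ + q - + 2 * -3ℤ ℤ.^ e ×
        (∀ i → i ≢ 𝟘 → + 3 * + N 1# i ≡ + q + -3ℤ ℤ.^ e)
      root =
        let e , m+1≡2e , N₀≡ , N₁≡ = even-counts (-1-square even)
            N₁≡′ = trans N₁≡ (cong (λ x → x + -3ℤ ℤ.^ e) (sym q≡3M))
        in e , m+1≡2e , trans N₀≡ (cong (λ x → x - + 2 * -3ℤ ℤ.^ e) (sym q≡3M)) ,
           λ { 𝟘  0≢0 → contradiction refl 0≢0
             ; 𝟙  _   → N₁≡′
             ; -𝟙 _   → trans (cong (λ n → + 3 * + n) (sym (N-±1 (-1-square even)))) N₁≡′ }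

  module _ {a γ δ : Fin q} (b : Fin q) (i : 𝔽₃) (γ≢0 : γ ≢ 0#) (-a≡γ² : - a ≡ γ ^ 2) (δγ≡1 : δ K.* γ ≡ 1#)
           (Tbδ³≡i : T (b K.* δ ^ 3) ≡ embed i) where

    open ≡-Reasoning

    δ≢0 : δ ≢ 0#
    δ≢0 δ≡0 = K.0≢1 (trans (sym (K.zeroˡ γ)) (trans (cong (K._* γ) (sym δ≡0)) δγ≡1))

    δ³≢0 : δ ^ 3 ≢ 0#
    δ³≢0 = δ≢0 ∘ K.^≡0⇒≡0 3

    δ³≡δ²δ : δ ^ 3 ≡ δ ^ 2 K.* δ
    δ³≡δ²δ = K.solve 1 (λ d → d K.:^ 3 K.:= d K.:^ 2 K.:* d) refl δ

    -- Since δ³ = δ² δ and δ γ = 1, the coefficient δ³ lies in the square class of γ, so the form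
    -- may be replaced by y².
    point-count-square : IsSquare γ → ∀ t → + 3 * + N 1# i ≡ + q + t → + suc (affineCount a b) ≡ + q + + 1 + t
    point-count-square sq t = point-count (affineCount a b) (N 1# i) t
      (trans (affineCount-square b i γ≢0 -a≡γ² δγ≡1 Tbδ³≡i) (cong (3 ℕ.*_) (N-square δ³≢0 δ³-square i)))
      where
      δ³-square : IsSquare (δ ^ 3)
      δ³-square = subst IsSquare (sym δ³≡δ²δ) (square-* (δ , refl)
        (square-cancel γ≢0 sq (subst IsSquare (trans (sym δγ≡1) (K.*-comm δ γ)) 1-square)))

    point-count-nonsquare : ¬ IsSquare γ → ∀ t → + 3 * + N 1# i ≡ + q + t → + suc (affineCount a b) ≡ + q + + 1 - t
    point-count-nonsquare ¬sq t 3N≡ = point-count (affineCount a b) (N (δ ^ 3) i) (ℤ.- t) (affineCount-square b i γ≢0 -a≡γ² δγ≡1 Tbδ³≡i)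
      (3N-twist t (¬sq ∘ γ-square) i 3N≡)
      where
      γ-square : IsSquare (δ ^ 3) → IsSquare γ
      γ-square sq = square-cancel δ≢0
        (square-cancel (δ≢0 ∘ K.^≡0⇒≡0 2) (δ , refl) (subst IsSquare δ³≡δ²δ sq))
        (subst IsSquare (sym δγ≡1) 1-square)

  -- In odd degree -1 is a nonsquare, so y or -y is a square u²; either way u⁴ = y².
  square⇒fourth-power : ¬ (2 ∣ suc m) → ∀ {x} → IsSquare x → ∃[ u ] u ^ 4 ≡ x
  square⇒fourth-power odd (y , refl) = case (isSquare? y)
    where
    case : Dec (IsSquare y) → ∃[ u ] u ^ 4 ≡ y ^ 2
    case (yes (u , refl)) = u , K.solve 1 (λ u → u K.:^ 4 K.:= (u K.:^ 2) K.:^ 2) refl u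
    case (no ¬sq) =
      let u , u²≡-y = nonsquare-* (-1-nonsquare odd) ¬sq
      in u , trans (K.solve 1 (λ u → u K.:^ 4 K.:= (u K.:^ 2) K.:^ 2) refl u)
               (trans (cong (_^ 2) u²≡-y) (K.solve 1 (λ y → ((K.:- K.con 𝟙) K.:* y) K.:^ 2 K.:= y K.:^ 2) refl y))

-- Transport of the field to `Fin q` and back.

module Transfer {c ℓ₁ ℓ₂} (F : HeytingField c ℓ₁ ℓ₂) {q : ℕ} (F-order : HasOrder F q) where

  open Field F
  open Inverse F-order using (to; from; to-cong; from-cong; strictlyInverseˡ; strictlyInverseʳ)
  open HeytingProperties heytingCommutativeRing using (x-0≈x; 1#0; invertibleˡ⇒#)

  K-rawRing : RawRing _ _
  K-rawRing = record
    { Carrier = Fin q ; _≈_ = _≡_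
    ; _+_ = λ x y → from (to x + to y) ; _*_ = λ x y → from (to x * to y) ; -_ = λ x → from (- to x)
    ; 0# = from 0# ; 1# = from 1# }

  to-injective : ∀ {x y} → to x ≈ to y → x ≡ y
  to-injective {x} {y} e = ≡.trans (≡.sym (strictlyInverseʳ x)) (≡.trans (from-cong e) (strictlyInverseʳ y))

  -- The operations on `Fin q` are defined by transport, so each law is one instance of the
  -- bijection; the ring axioms are then pulled back along the injection `to`.
  to-isRingMonomorphism : IsRingMonomorphism K-rawRing rawRing to
  to-isRingMonomorphism = record
    { isRingHomomorphism = record
      { isSemiringHomomorphism = record
        { isNearSemiringHomomorphism = record
          { +-isMonoidHomomorphism = record
            { isMagmaHomomorphism = record
              { isRelHomomorphism = record { cong = to-cong }
              ; homo = λ _ _ → strictlyInverseˡ _ }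
            ; ε-homo = strictlyInverseˡ _ }
          ; *-homo = λ _ _ → strictlyInverseˡ _ }
        ; 1#-homo = strictlyInverseˡ _ }
      ; -‿homo = λ _ → strictlyInverseˡ _ }
    ; injective = to-injective }

  from≡0⇒≈0 : ∀ {x} → from x ≡ from 0# → x ≈ 0#
  from≡0⇒≈0 e = trans (sym (strictlyInverseˡ _)) (trans (to-cong e) (strictlyInverseˡ _))

  #0⇒from≢0 : ∀ {x} → x # 0# → from x ≢ from 0#
  #0⇒from≢0 x#0 e = #-irrefl (from≡0⇒≈0 e) x#0

  -- Invertibility is decidable by search, and an element that is not invertible is 0 by tightness.
  K-inverse : ∀ x → x ≢ from 0# → ∃[ y ] from (to y * to x) ≡ from 1#
  K-inverse x x≢0 with any? (λ y → from (to y * to x) ≟ from 1#)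
  ... | yes inverse = inverse
  ... | no ∄inverse = contradiction (to-injective (trans (proj₁ (tight (to x) 0#) not-apart) (sym (strictlyInverseˡ 0#)))) x≢0
    where
    not-apart : ¬ (to x # 0#)
    not-apart x#0 = ∄inverse (from (inv x#0) , from-cong (trans (*-cong (strictlyInverseˡ _) (sym (x-0≈x (to x)))) (proj₁ (proj₂ (#⇒invertible x#0)))))

  K : FiniteField q
  K = record
    { isCommutativeRing = RingMonomorphism.isCommutativeRing to-isRingMonomorphism isCommutativeRing
    ; 0≢1 = λ e → #0⇒from≢0 1#0 (≡.sym e)
    ; inverse = K-inverse }

  private
    module K = FiniteField K

  to-+ : ∀ x y → to (x K.+ y) ≈ to x + to y
  to-+ x y = strictlyInverseˡ _

  to-* : ∀ x y → to (x K.* y) ≈ to x * to y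
  to-* x y = strictlyInverseˡ _

  to-^ : ∀ x k → to (x K.^ k) ≈ to x ^ k
  to-^ x zero    = strictlyInverseˡ 1#
  to-^ x (suc k) = trans (to-* x (x K.^ k)) (*-cong refl (to-^ x k))

  from-* : ∀ x y → from x K.* from y ≡ from (x * y)
  from-* x y = from-cong (*-cong (strictlyInverseˡ x) (strictlyInverseˡ y))

  from-neg : ∀ x → K.- from x ≡ from (- x)
  from-neg x = from-cong (-‿cong (strictlyInverseˡ x))

  from-^ : ∀ x k → from x K.^ k ≡ from (x ^ k)
  from-^ x zero    = ≡.refl
  from-^ x (suc k) = ≡.trans (cong (from x K.*_) (from-^ x k)) (from-* x (x ^ k))

  ≢0⇒to#0 : ∀ {x} → x ≢ K.0# → to x # 0#
  ≢0⇒to#0 {x} x≢0 with y , yx≡1 ← K-inverse x x≢0 = invertibleˡ⇒#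
    (to y , trans (*-cong refl (x-0≈x (to x))) (trans (sym (strictlyInverseˡ _)) (trans (to-cong yx≡1) (strictlyInverseˡ 1#))))

  inv-inverse : ∀ {x} (x#0 : x # 0#) → from (inv x#0) K.* from x ≡ K.1#
  inv-inverse {x} x#0 = ≡.trans (from-* (inv x#0) x)
    (from-cong (trans (*-cong refl (sym (x-0≈x x))) (proj₁ (proj₂ (#⇒invertible x#0)))))

module TernaryTransfer {c ℓ₁ ℓ₂} (F : HeytingField c ℓ₁ ℓ₂) {m : ℕ} (F-order : HasOrder F (3 ℕ.^ suc m)) where

  open Field F
  open Inverse F-order using (to; from; to-cong; strictlyInverseˡ; strictlyInverseʳ)
  open Transfer F F-order public
  private
    module K = TernaryField {m} K
    module F = CommutativeRing commutativeRing
  open MonoidSum F.+-monoid using (sum-cong-≋)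
  open Exp F.semiring using (^-assocʳ; ^-congˡ)

  -- After the term i = 0 of `Tr`, the remaining conjugates of x are the conjugates of x³, which is
  -- the recursion of `Trace`.
  to-Trace : ∀ k x → to (K.Trace k x) ≈ Tr k (to x)
  to-Trace zero    x = strictlyInverseˡ 0#
  to-Trace (suc k) x = begin
    to (K.Trace k (x K.^ 3) K.+ x)                                    ≈⟨ to-+ _ x ⟩
    to (K.Trace k (x K.^ 3)) + to x                                   ≈⟨ +-comm _ (to x) ⟩
    to x + to (K.Trace k (x K.^ 3))                                   ≈⟨ +-cong (sym (*-identityʳ (to x))) (to-Trace k (x K.^ 3)) ⟩
    to x ^ 1 + Tr k (to (x K.^ 3))                                    ≈⟨ +-cong refl (sum-cong-≋ {k} power) ⟩
    Tr (suc k) (to x)                                                 ∎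
    where
    open SetoidReasoning setoid
    power : ∀ (i : Fin k) → to (x K.^ 3) ^ (3 ℕ.^ toℕ i) ≈ to x ^ (3 ℕ.^ suc (toℕ i))
    power i = trans (^-congˡ (3 ℕ.^ toℕ i) (to-^ x 3)) (^-assocʳ (to x) 3 (3 ℕ.^ toℕ i))

  Tr-cong : ∀ k {x y} → x ≈ y → Tr k x ≈ Tr k y
  Tr-cong k x≈y = sum-cong-≋ {k} (λ i → ^-congˡ (3 ℕ.^ toℕ i) x≈y)

  from-Tr : ∀ x → K.T (from x) ≡ from (Tr (suc m) x)
  from-Tr x = to-injective (trans (to-Trace (suc m) (from x)) (trans (Tr-cong (suc m) (strictlyInverseˡ x)) (sym (strictlyInverseˡ _))))

  module _ (E : ShortWeierstrass F) where

    open ShortWeierstrass E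
    open Curve F E
    open Curve.Rational F E F-order using (#E; elements) renaming (_≟_ to _≟F_)
    open TraceForms {m} K using (affineCount)

    #E≡ : #E ≡ suc (affineCount (from a₄) (from a₆))
    #E≡ = cong suc (begin
      length (filter P? (cartesianProduct elements elements))     ≡⟨ cong (λ es → length (filter P? (cartesianProduct es es))) (map-tabulate id to) ⟩
      _                                                           ≡⟨ length-filter-cartesianProduct P? to to ⟩
      ∑ (λ x → ∑ (λ y → ⟦ P? (to x , to y) ⟧))                    ≡⟨ ∑-cong (λ x → ∑-cong (λ y → ⟦⟧-cong (P? (to x , to y)) (y K.^ 2 ≟ x K.^ 3 K.+ from a₄ K.* x K.+ from a₆)
        (λ e → to-injective (trans (to-^ y 2) (trans e (sym (to-rhs x)))))
        (λ e → trans (sym (to-^ y 2)) (trans (to-cong e) (to-rhs x))))) ⟩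
      affineCount (from a₄) (from a₆)                             ∎)
      where
      open ≡.≡-Reasoning
      P? : ∀ ((x , y) : Carrier × Carrier) → Dec (y ^ 2 ≈ x ^ 3 + a₄ * x + a₆)
      P? (x , y) = (y ^ 2) ≟F (x ^ 3 + a₄ * x + a₆)
      to-rhs : ∀ x → to (x K.^ 3 K.+ from a₄ K.* x K.+ from a₆) ≈ to x ^ 3 + a₄ * to x + a₆
      to-rhs x = trans (to-+ _ (from a₆)) (+-cong (trans (to-+ _ _)
        (+-cong (to-^ x 3) (trans (to-* (from a₄) x) (*-cong (strictlyInverseˡ a₄) refl)))) (strictlyInverseˡ a₆))


    3•≈0 : ∀ x → 3 • x ≈ 0#
    3•≈0 x = begin
      x + (x + (x + 0#))                             ≈⟨ +-cong x≈ (+-cong x≈ (+-cong x≈ (sym (strictlyInverseˡ 0#)))) ⟩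
      x′ + (x′ + (x′ + to K.0#))                     ≈⟨ +-cong refl (+-cong refl (sym (to-+ _ _))) ⟩
      x′ + (x′ + to (from x K.+ K.0#))               ≈⟨ trans (+-cong refl (sym (to-+ _ _))) (sym (to-+ _ _)) ⟩
      to (from x K.+ (from x K.+ (from x K.+ K.0#))) ≈⟨ to-cong (K.solve 1 (λ x → x K.:+ (x K.:+ (x K.:+ K.con 𝟘)) K.:= K.con 𝟘) ≡.refl (from x)) ⟩
      to K.0#                                        ≈⟨ strictlyInverseˡ 0# ⟩
      0#                                             ∎
      where
      open SetoidReasoning setoid
      x′ = to (from x)
      x≈ : x ≈ x′
      x≈ = sym (strictlyInverseˡ x)

    •-≈0 : ∀ n {x} → x ≈ 0# → n • x ≈ 0#
    •-≈0 zero    x≈0 = refl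
    •-≈0 (suc n) x≈0 = trans (+-cong x≈0 (•-≈0 n x≈0)) (+-identityˡ 0#)

    -- For a₄ = 0 the discriminant reduces to -16 · 27 a₆², and 27 vanishes in characteristic 3.
    a₄≢0 : IsElliptic → from a₄ ≢ K.0#
    a₄≢0 elliptic from-a₄≡0 = #-irrefl (begin
      - (16 • (4 • a₄ ^ 3 + 27 • a₆ ^ 2))    ≈⟨ -‿cong (•-≈0 16 (trans (+-cong (•-≈0 4 a₄³≈0) 27•≈0) (+-identityˡ 0#))) ⟩
      - 0#                                   ≈⟨ -0#≈0# ⟩
      0#                                     ∎) elliptic
      where
      open SetoidReasoning setoid
      open RingProperties F.ring using (-0#≈0#)
      open MonoidMult F.+-monoid using (×-assocˡ)
      a₄³≈0 : a₄ ^ 3 ≈ 0#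
      a₄³≈0 = trans (*-cong (from≡0⇒≈0 from-a₄≡0) refl) (zeroˡ _)
      27•≈0 : 27 • a₆ ^ 2 ≈ 0#
      27•≈0 = trans (sym (×-assocˡ (a₆ ^ 2) 9 3)) (•-≈0 9 (3•≈0 (a₆ ^ 2)))

-- The number of points on the curve, case by case.

module CurveCounts {c ℓ₁ ℓ₂} (F : HeytingField c ℓ₁ ℓ₂) {m : ℕ} (F-order : HasOrder F (3 ℕ.^ suc m))
                   (E : ShortWeierstrass F) (elliptic : Curve.IsElliptic F E) where

  open Field F
  open ShortWeierstrass E
  open Curve.Rational F E F-order using (#E)
  open Inverse F-order using (to; from; to-cong; from-cong; strictlyInverseˡ; strictlyInverseʳ)
  open TernaryTransfer F {m} F-order
  private
    module K = TernaryField {m} K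
    q : ℕ
    q = 3 ℕ.^ suc m
  open Squares {m} K
  open TraceForms {m} K
  open PointCounts {m} K

  -a : Fin q
  -a = K.- from a₄

  -a≢0 : -a ≢ K.0#
  -a≢0 -a≡0 = a₄≢0 E elliptic (neg-injective (≡.trans -a≡0 (K.solve 0 (K.con 𝟘 K.:= K.:- K.con 𝟘) ≡.refl)))

  -a≡from^ : ∀ {w} k → - a₄ ≈ w ^ k → -a ≡ from w K.^ k
  -a≡from^ {w} k e = ≡.trans (from-neg a₄) (≡.trans (from-cong e) (≡.sym (from-^ w k)))

  -a≡⇒ : ∀ {u} k → u K.^ k ≡ -a → - a₄ ≈ to u ^ k
  -a≡⇒ {u} k e = trans (sym (strictlyInverseˡ (- a₄))) (trans (to-cong (≡.trans (≡.sym (from-neg a₄)) (≡.sym e))) (to-^ u k))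

  root-≢0 : ∀ {u} k → u K.^ suc k ≡ -a → u ≢ K.0#
  root-≢0 k e ≡.refl = -a≢0 (≡.trans (≡.sym e) (K.zeroˡ _))

  square⇒ : ∀ {x} → IsNonzeroSquare x → IsSquare (from x)
  square⇒ (w , _ , x≈w²) = from w , ≡.trans (from-^ w 2) (from-cong (sym x≈w²))

  square⇐ : ∀ {x} → x # 0# → IsSquare (from x) → IsNonzeroSquare x
  square⇐ {x} x#0 (y , y²≡x) = to y , ≢0⇒to#0 (λ { ≡.refl → #0⇒from≢0 x#0 (≡.trans (≡.sym y²≡x) (K.zeroˡ _)) }) ,
    trans (sym (strictlyInverseˡ x)) (trans (to-cong (≡.sym y²≡x)) (to-^ y 2))

  nonsquare-count : ¬ IsSquare -a → + #E ≡ + q ℤ.+ + 1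
  nonsquare-count ¬sq = ≡.trans (cong +_ (#E≡ E)) (≡.trans (cong (λ n → + suc n) (affineCount-nonsquare (from a₆) ¬sq))
    (ℤ.+-comm (+ 1) (+ q)))

  ¬square-count : ¬ IsNonzeroSquare (- a₄) → + #E ≡ + q ℤ.+ + 1
  ¬square-count ¬sq = nonsquare-count (λ (y , y²≡-a) → ¬sq (to y , ≢0⇒to#0 (root-≢0 1 y²≡-a) , -a≡⇒ 2 y²≡-a))

  -- In odd degree every square is a fourth power, so -a₄ is not even a square.
  ¬fourth-power-count : ¬ (2 ∣ suc m) → ¬ IsNonzeroFourthPower (- a₄) → + #E ≡ + q ℤ.+ + 1
  ¬fourth-power-count odd ¬4th = nonsquare-count (λ sq →
    let u , u⁴≡-a = square⇒fourth-power odd sq in ¬4th (to u , ≢0⇒to#0 (root-≢0 3 u⁴≡-a) , -a≡⇒ 4 u⁴≡-a))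

  from-b*^ : ∀ {w} k → K.T (from a₆ K.* from w K.^ k) ≡ from (Tr (suc m) (a₆ * w ^ k))
  from-b*^ {w} k = ≡.trans (cong K.T (≡.trans (cong (from a₆ K.*_) (from-^ w k)) (from-* a₆ (w ^ k)))) (from-Tr (a₆ * w ^ k))

  -- The case γ = v² and δ = v⁻²: here γ is a square by construction, and δ³ = v⁻⁶ explains the
  -- argument of the trace.
  fourth-power-count : ∀ {v} (v#0 : v # 0#) → - a₄ ≈ v ^ 4 → ∀ i → from (Tr (suc m) (a₆ * inv v#0 ^ 6)) ≡ K.embed i →
    ∀ t → + 3 ℤ.* + N K.1# i ≡ + q ℤ.+ t → + #E ≡ + q ℤ.+ + 1 ℤ.+ t
  fourth-power-count {v} v#0 -a₄≈v⁴ i Tr≡i t 3N≡ = ≡.trans (cong +_ (#E≡ E))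
    (point-count-square {γ = from v K.^ 2} {δ = w K.^ 2} (from a₆) i (λ e → #0⇒from≢0 v#0 (K.^≡0⇒≡0 2 e))
      (≡.trans (-a≡from^ 4 -a₄≈v⁴) (K.solve 1 (λ v → v K.:^ 4 K.:= (v K.:^ 2) K.:^ 2) ≡.refl (from v)))
      (≡.trans (K.solve 2 (λ w v → w K.:^ 2 K.:* v K.:^ 2 K.:= (w K.:* v) K.:^ 2) ≡.refl w (from v))
        (≡.trans (cong (K._^ 2) (inv-inverse v#0)) (K.solve 0 (K.con 𝟙 K.:^ 2 K.:= K.con 𝟙) ≡.refl)))
      (≡.trans (cong (λ x → K.T (from a₆ K.* x)) (K.solve 1 (λ w → (w K.:^ 2) K.:^ 3 K.:= w K.:^ 6) ≡.refl w))
        (≡.trans (from-b*^ 6) Tr≡i))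
      (from v , ≡.refl) t 3N≡)
    where w = from (inv v#0)

  module _ {γ : Carrier} (γ#0 : γ # 0#) (-a₄≈γ² : - a₄ ≈ γ ^ 2) (i : 𝔽₃)
           (Tr≡i : from (Tr (suc m) (a₆ * inv γ#0 ^ 3)) ≡ K.embed i) where

    square-root-count : IsNonzeroSquare γ → ∀ t → + 3 ℤ.* + N K.1# i ≡ + q ℤ.+ t → + #E ≡ + q ℤ.+ + 1 ℤ.+ t
    square-root-count sq t 3N≡ = ≡.trans (cong +_ (#E≡ E))
      (point-count-square (from a₆) i (#0⇒from≢0 γ#0) (-a≡from^ 2 -a₄≈γ²) (inv-inverse γ#0)
        (≡.trans (from-b*^ 3) Tr≡i) (square⇒ sq) t 3N≡)

    nonsquare-root-count : ¬ IsNonzeroSquare γ → ∀ t → + 3 ℤ.* + N K.1# i ≡ + q ℤ.+ t → + #E ≡ + q ℤ.+ + 1 ℤ.- t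
    nonsquare-root-count ¬sq t 3N≡ = ≡.trans (cong +_ (#E≡ E))
      (point-count-nonsquare (from a₆) i (#0⇒from≢0 γ#0) (-a≡from^ 2 -a₄≈γ²) (inv-inverse γ#0)
        (≡.trans (from-b*^ 3) Tr≡i) (¬sq ∘ square⇐ γ#0) t 3N≡)

  from-neg1 : from (- 1#) ≡ K.embed -𝟙
  from-neg1 = ≡.sym (from-neg 1#)

  module OddDegree (odd : ¬ (2 ∣ suc m)) where

    private
      j : ℕ
      j = proj₁ (Odd.root odd)

      m≡2j : m ≡ j ℕ.+ j
      m≡2j = proj₁ (proj₂ (Odd.root odd))

    -- From m = 2 j it follows that 3 q = 3 ^ (2 j + 2).
    √3q : ℕ
    √3q = 3 ℕ.^ suc j

    √3q² : √3q ℕ.* √3q ≡ 3 ℕ.* q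
    √3q² = ≡.trans (≡.sym (ℕ.^-distribˡ-+-* 3 (suc j) (suc j)))
      (cong (3 ℕ.^_) (≡.trans (cong suc (ℕ.+-suc j j)) (cong (λ m → suc (suc m)) (≡.sym m≡2j))))

    private
      d≡1 : suc m % 4 ≡ 1 → + 3 ℤ.* -3ℤ ℤ.^ j ≡ + √3q
      d≡1 e = scale-+ 3 (3 ℕ.^ j) (proj₁ (-3^-% j 1 (s≤s z≤n)) (subst (λ m → suc m % 4 ≡ 1) m≡2j e))

      d≡3 : suc m % 4 ≡ 3 → + 3 ℤ.* -3ℤ ℤ.^ j ≡ ℤ.- + √3q
      d≡3 e = scale-neg 3 (3 ℕ.^ j) (proj₂ (-3^-% j 1 (s≤s z≤n)) (subst (λ m → suc m % 4 ≡ 3) m≡2j e))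

      3N₀ : + 3 ℤ.* + N K.1# 𝟘 ≡ + q ℤ.+ + 0
      3N₀ = proj₁ (proj₂ (proj₂ (Odd.root odd)))

      3N₁ : ∀ s → + 3 ℤ.* -3ℤ ℤ.^ j ≡ s → + 3 ℤ.* + N K.1# 𝟙 ≡ + q ℤ.+ s
      3N₁ s e = ≡.trans (proj₁ (proj₂ (proj₂ (proj₂ (Odd.root odd))))) (cong (λ s → + q ℤ.+ s) e)

      3N₂ : ∀ s → ℤ.- (+ 3 ℤ.* -3ℤ ℤ.^ j) ≡ s → + 3 ℤ.* + N K.1# -𝟙 ≡ + q ℤ.+ s
      3N₂ s e = ≡.trans (proj₂ (proj₂ (proj₂ (proj₂ (Odd.root odd))))) (cong (λ s → + q ℤ.+ s) e)

    module FourthPower {v : Carrier} (v#0 : v # 0#) (-a₄≈v⁴ : - a₄ ≈ v ^ 4) where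

      private
        t : Carrier
        t = Tr (suc m) (a₆ * inv v#0 ^ 6)

      trace-0 : t ≈ 0# → + #E ≡ + q ℤ.+ + 1
      trace-0 t≈0 = ≡.trans (fourth-power-count v#0 -a₄≈v⁴ 𝟘 (from-cong t≈0) (+ 0) 3N₀) (ℤ.+-identityʳ _)

      trace-1-d≡1 : t ≈ 1# → suc m % 4 ≡ 1 → + #E ≡ + q ℤ.+ + 1 ℤ.+ + √3q
      trace-1-d≡1 t≈1 e = fourth-power-count v#0 -a₄≈v⁴ 𝟙 (from-cong t≈1) (+ √3q) (3N₁ (+ √3q) (d≡1 e))

      trace-1-d≡3 : t ≈ 1# → suc m % 4 ≡ 3 → + #E ≡ + q ℤ.+ + 1 ℤ.- + √3q
      trace-1-d≡3 t≈1 e = fourth-power-count v#0 -a₄≈v⁴ 𝟙 (from-cong t≈1) (ℤ.- + √3q) (3N₁ (ℤ.- + √3q) (d≡3 e))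

      trace-neg1-d≡1 : t ≈ - 1# → suc m % 4 ≡ 1 → + #E ≡ + q ℤ.+ + 1 ℤ.- + √3q
      trace-neg1-d≡1 t≈-1 e = fourth-power-count v#0 -a₄≈v⁴ -𝟙 (≡.trans (from-cong t≈-1) from-neg1) (ℤ.- + √3q) (3N₂ (ℤ.- + √3q) (cong (λ s → ℤ.- s) (d≡1 e)))

      trace-neg1-d≡3 : t ≈ - 1# → suc m % 4 ≡ 3 → + #E ≡ + q ℤ.+ + 1 ℤ.+ + √3q
      trace-neg1-d≡3 t≈-1 e = fourth-power-count v#0 -a₄≈v⁴ -𝟙 (≡.trans (from-cong t≈-1) from-neg1) (+ √3q) (3N₂ (+ √3q) (neg-swap (+ 3 ℤ.* -3ℤ ℤ.^ j) √3q (d≡3 e)))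

  nonzero-trace : ∀ x → Tr (suc m) x # 0# → ∃[ i ] i ≢ 𝟘 × from (Tr (suc m) x) ≡ K.embed i
  nonzero-trace x t#0 =
    let i , Tx≡i = K.trace (from x)
        t≡i      = ≡.trans (≡.sym (from-Tr x)) Tx≡i
    in i , (λ i≡0 → #0⇒from≢0 t#0 (≡.trans t≡i (cong K.embed i≡0))) , t≡i

  module EvenDegree (even : 2 ∣ suc m) where

    private
      e : ℕ
      e = proj₁ (Even.root even)

      d≡2e : suc m ≡ e ℕ.+ e
      d≡2e = proj₁ (proj₂ (Even.root even))

    √q : ℕ
    √q = 3 ℕ.^ e

    √q² : √q ℕ.* √q ≡ q
    √q² = ≡.trans (≡.sym (ℕ.^-distribˡ-+-* 3 e e)) (cong (3 ℕ.^_) (≡.sym d≡2e))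

    private
      d≡0 : suc m % 4 ≡ 0 → -3ℤ ℤ.^ e ≡ + √q
      d≡0 h = proj₁ (-3^-% e 0 z≤n) (subst (λ d → d % 4 ≡ 0) d≡2e h)

      d≡2 : suc m % 4 ≡ 2 → -3ℤ ℤ.^ e ≡ ℤ.- + √q
      d≡2 h = proj₂ (-3^-% e 0 z≤n) (subst (λ d → d % 4 ≡ 2) d≡2e h)

      3N₀ : ∀ s → ℤ.- (+ 2 ℤ.* -3ℤ ℤ.^ e) ≡ s → + 3 ℤ.* + N K.1# 𝟘 ≡ + q ℤ.+ s
      3N₀ s h = ≡.trans (proj₁ (proj₂ (proj₂ (Even.root even)))) (cong (λ s → + q ℤ.+ s) h)

      3N₀-d≡0 : suc m % 4 ≡ 0 → + 3 ℤ.* + N K.1# 𝟘 ≡ + q ℤ.- + (2 ℕ.* √q)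
      3N₀-d≡0 h = 3N₀ (ℤ.- + (2 ℕ.* √q)) (cong (λ s → ℤ.- s) (scale-+ 2 √q (d≡0 h)))

      3N₀-d≡2 : suc m % 4 ≡ 2 → + 3 ℤ.* + N K.1# 𝟘 ≡ + q ℤ.+ + (2 ℕ.* √q)
      3N₀-d≡2 h = 3N₀ (+ (2 ℕ.* √q)) (neg-swap (+ 2 ℤ.* -3ℤ ℤ.^ e) (2 ℕ.* √q) (scale-neg 2 √q (d≡2 h)))

      3Nᵢ : ∀ i s → i ≢ 𝟘 → -3ℤ ℤ.^ e ≡ s → + 3 ℤ.* + N K.1# i ≡ + q ℤ.+ s
      3Nᵢ i s i≢0 h = ≡.trans (proj₂ (proj₂ (proj₂ (Even.root even))) i i≢0) (cong (λ s → + q ℤ.+ s) h)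

    module SquareRoot {γ : Carrier} (γ#0 : γ # 0#) (-a₄≈γ² : - a₄ ≈ γ ^ 2) (sq : IsNonzeroSquare γ) where

      private
        t : Carrier
        t = Tr (suc m) (a₆ * inv γ#0 ^ 3)

      trace-0-d≡0 : t ≈ 0# → suc m % 4 ≡ 0 → + #E ≡ + q ℤ.+ + 1 ℤ.- + (2 ℕ.* √q)
      trace-0-d≡0 t≈0 h = square-root-count γ#0 -a₄≈γ² 𝟘 (from-cong t≈0) sq (ℤ.- + (2 ℕ.* √q)) (3N₀-d≡0 h)

      trace-0-d≡2 : t ≈ 0# → suc m % 4 ≡ 2 → + #E ≡ + q ℤ.+ + 1 ℤ.+ + (2 ℕ.* √q)
      trace-0-d≡2 t≈0 h = square-root-count γ#0 -a₄≈γ² 𝟘 (from-cong t≈0) sq (+ (2 ℕ.* √q)) (3N₀-d≡2 h)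

      trace-≢0-d≡0 : t # 0# → suc m % 4 ≡ 0 → + #E ≡ + q ℤ.+ + 1 ℤ.+ + √q
      trace-≢0-d≡0 t#0 h = let i , i≢0 , t≡i = nonzero-trace (a₆ * inv γ#0 ^ 3) t#0 in
        square-root-count γ#0 -a₄≈γ² i t≡i sq (+ √q) (3Nᵢ i (+ √q) i≢0 (d≡0 h))

      trace-≢0-d≡2 : t # 0# → suc m % 4 ≡ 2 → + #E ≡ + q ℤ.+ + 1 ℤ.- + √q
      trace-≢0-d≡2 t#0 h = let i , i≢0 , t≡i = nonzero-trace (a₆ * inv γ#0 ^ 3) t#0 in
        square-root-count γ#0 -a₄≈γ² i t≡i sq (ℤ.- + √q) (3Nᵢ i (ℤ.- + √q) i≢0 (d≡2 h))

    module NonsquareRoot {γ : Carrier} (γ#0 : γ # 0#) (-a₄≈γ² : - a₄ ≈ γ ^ 2) (¬sq : ¬ IsNonzeroSquare γ) where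

      private
        t : Carrier
        t = Tr (suc m) (a₆ * inv γ#0 ^ 3)

      trace-0-d≡0 : t ≈ 0# → suc m % 4 ≡ 0 → + #E ≡ + q ℤ.+ + 1 ℤ.+ + (2 ℕ.* √q)
      trace-0-d≡0 t≈0 h = ≡.trans (nonsquare-root-count γ#0 -a₄≈γ² 𝟘 (from-cong t≈0) ¬sq (ℤ.- + (2 ℕ.* √q)) (3N₀-d≡0 h))
        (cong (λ s → + q ℤ.+ + 1 ℤ.+ s) (ℤ.neg-involutive (+ (2 ℕ.* √q))))

      trace-0-d≡2 : t ≈ 0# → suc m % 4 ≡ 2 → + #E ≡ + q ℤ.+ + 1 ℤ.- + (2 ℕ.* √q)
      trace-0-d≡2 t≈0 h = nonsquare-root-count γ#0 -a₄≈γ² 𝟘 (from-cong t≈0) ¬sq (+ (2 ℕ.* √q)) (3N₀-d≡2 h)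

      trace-≢0-d≡0 : t # 0# → suc m % 4 ≡ 0 → + #E ≡ + q ℤ.+ + 1 ℤ.- + √q
      trace-≢0-d≡0 t#0 h = let i , i≢0 , t≡i = nonzero-trace (a₆ * inv γ#0 ^ 3) t#0 in
        nonsquare-root-count γ#0 -a₄≈γ² i t≡i ¬sq (+ √q) (3Nᵢ i (+ √q) i≢0 (d≡0 h))

      trace-≢0-d≡2 : t # 0# → suc m % 4 ≡ 2 → + #E ≡ + q ℤ.+ + 1 ℤ.+ + √q
      trace-≢0-d≡2 t#0 h = let i , i≢0 , t≡i = nonzero-trace (a₆ * inv γ#0 ^ 3) t#0 in
        ≡.trans (nonsquare-root-count γ#0 -a₄≈γ² i t≡i ¬sq (ℤ.- + √q) (3Nᵢ i (ℤ.- + √q) i≢0 (d≡2 h)))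
          (cong (λ s → + q ℤ.+ + 1 ℤ.+ s) (ℤ.neg-involutive (+ √q)))

mainTheorem5 : ∀ {c ℓ₁ ℓ₂} (F : HeytingField c ℓ₁ ℓ₂) (d : ℕ) → 1 ℕ.≤ d →
    let q = 3 ℕ.^ d in
    (F-order : HasOrder F q) (E : ShortWeierstrass F) →
    Curve.IsElliptic F E →
    IsSupersingular 3 F E →
    let open Field F
        open ShortWeierstrass E
        open Curve.Rational F E F-order using (#E)
    in
    (¬ (2 ∣ d) →
      (∃[ √3q ] √3q ℕ.* √3q ≡ 3 ℕ.* q ×
        (∀ v (v#0 : v # 0#) → - a₄ ≈ v ^ 4 →
          let t = Tr d (a₆ * inv v#0 ^ 6) in
          (t ≈ 0# → + #E ≡ + q ℤ.+ + 1) ×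
          (t ≈ 1# → d % 4 ≡ 1 → + #E ≡ + q ℤ.+ + 1 ℤ.+ + √3q) ×
          (t ≈ 1# → d % 4 ≡ 3 → + #E ≡ + q ℤ.+ + 1 ℤ.- + √3q) ×
          (t ≈ - 1# → d % 4 ≡ 1 → + #E ≡ + q ℤ.+ + 1 ℤ.- + √3q) ×
          (t ≈ - 1# → d % 4 ≡ 3 → + #E ≡ + q ℤ.+ + 1 ℤ.+ + √3q))) ×
      (¬ IsNonzeroFourthPower (- a₄) → + #E ≡ + q ℤ.+ + 1)) ×
    (2 ∣ d →
      (∃[ √q ] √q ℕ.* √q ≡ q ×
        (∀ γ (γ#0 : γ # 0#) → - a₄ ≈ γ ^ 2 → IsNonzeroSquare γ →
          let t = Tr d (a₆ * inv γ#0 ^ 3) in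
          (t ≈ 0# → d % 4 ≡ 0 → + #E ≡ + q ℤ.+ + 1 ℤ.- + (2 ℕ.* √q)) ×
          (t ≈ 0# → d % 4 ≡ 2 → + #E ≡ + q ℤ.+ + 1 ℤ.+ + (2 ℕ.* √q)) ×
          (t # 0# → d % 4 ≡ 0 → + #E ≡ + q ℤ.+ + 1 ℤ.+ + √q) ×
          (t # 0# → d % 4 ≡ 2 → + #E ≡ + q ℤ.+ + 1 ℤ.- + √q)) ×
        (∀ γ (γ#0 : γ # 0#) → - a₄ ≈ γ ^ 2 → ¬ IsNonzeroSquare γ →
          let t = Tr d (a₆ * inv γ#0 ^ 3) in
          (t ≈ 0# → d % 4 ≡ 0 → + #E ≡ + q ℤ.+ + 1 ℤ.+ + (2 ℕ.* √q)) ×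
          (t ≈ 0# → d % 4 ≡ 2 → + #E ≡ + q ℤ.+ + 1 ℤ.- + (2 ℕ.* √q)) ×
          (t # 0# → d % 4 ≡ 0 → + #E ≡ + q ℤ.+ + 1 ℤ.- + √q) ×
          (t # 0# → d % 4 ≡ 2 → + #E ≡ + q ℤ.+ + 1 ℤ.+ + √q))) ×
      (¬ IsNonzeroSquare (- a₄) → + #E ≡ + q ℤ.+ + 1))
-- The bound 1 ≤ d rules out degree 0; with d = m + 1 the number q / 3 is 3 ^ m.
mainTheorem5 F (suc m) _ F-order E elliptic _ =
  (λ odd → let open OddDegree odd in
    (√3q , √3q² , λ v v#0 -a₄≈v⁴ → let open FourthPower v#0 -a₄≈v⁴ in trace-0 , trace-1-d≡1 , trace-1-d≡3 , trace-neg1-d≡1 , trace-neg1-d≡3) ,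
    ¬fourth-power-count odd) ,
  (λ even → let open EvenDegree even in
    (√q , √q² ,
     (λ γ γ#0 -a₄≈γ² sq → let open SquareRoot γ#0 -a₄≈γ² sq in trace-0-d≡0 , trace-0-d≡2 , trace-≢0-d≡0 , trace-≢0-d≡2) ,
     (λ γ γ#0 -a₄≈γ² ¬sq → let open NonsquareRoot γ#0 -a₄≈γ² ¬sq in trace-0-d≡0 , trace-0-d≡2 , trace-≢0-d≡0 , trace-≢0-d≡2)) ,
    ¬square-count)
  where open CurveCounts F {m} F-order E elliptic
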